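{- Let $k=2^{\ell}$ with $\ell\ge2$ an integer and $q=4k$. Let $f\in\mathbb F_q[X,Y]$ be a local permutation polynomial whose permutation polynomial tuple consists of the $q$ elements of the group $G_1=\{b^ja^i:0\le j\le 2k-1,\ 0\le i\le 1\}$ (in some order), where $a$ and $b$ are as defined below. Then $f$ has a companion.
   Context: The elements of $\mathbb F_q$ are enumerated as $\mathbb F_q=\{c_0,\dots,c_{q-1}\}$; $\mathfrak S_q$ is the symmetric group of permutations of $\mathbb F_q$, composed right to left, $(\sigma\tau)(x)=\sigma(\tau(x))$, written in cycle notation. $a=(c_0,c_1)(c_2,c_3)\cdots(c_{4k-2},c_{4k-1})$ and $b=C_1C_2$, where $C_1$ is the $2k$-cycle whose entries in order are: for $m=0,1,\dots,\frac{k-2}{2}$ the pair $c_{2m},c_{2(2m+k-1)}$; then for $n=0,1,\dots,\frac{k-4}{2}$ the pair $c_{2n+k},c_{2(2n+k)}$; then $c_{4k-1},c_{4k-4}$; and $C_2$ is the $2k$-cycle whose entries in order are: for $m=0,1,\dots,\frac{k-2}{2}$ the pair $c_{2m+1},c_{2(2m+k)+1}$; then for $n=0,1,\dots,\frac{k-4}{2}$ the pair $c_{2n+k+1},c_{2(2n+k)-1}$; then $c_{4k-2},c_{4k-5}$. ($G_1$ is a subgroup of $\mathfrak S_q$ of order $q$ whose non-identity elements have no fixed points.) Every function $\mathbb F_q^2\to\mathbb F_q$ is identified with the unique polynomial in $\mathbb F_q[X,Y]$ of degree $<q$ in each variable representing it. $f$ is a local permutation polynomial (LPP) if $x\mapsto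 f(x,y_0)$ and $y\mapsto f(x_0,y)$ are permutations of $\mathbb F_q$ for all $x_0,y_0$. A permutation polynomial tuple is $(\beta_0,\dots,\beta_{q-1})\in\mathfrak S_q^q$ such that $\beta_i^{ -1}\beta_j$ has no fixed point whenever $i\ne j$; LPPs $f$ correspond bijectively to such tuples via $f(x,\beta_i(x))=c_i$ for all $x$ and all $i$. Two LPPs $f,g$ are orthogonal (companions) if for every $(u,v)\in\mathbb F_q^2$ the system $f(X,Y)=u$, $g(X,Y)=v$ has exactly one solution in $\mathbb F_q^2$; a companion of $f$ is an LPP orthogonal to $f$. -}

module Defs where

open import Level using (Level; _⊔_) renaming (suc to lsuc)
open import Algebra.Bundles using (CommutativeRing)
open import Data.Bool.Base using (if_then_else_)
open import Data.Fin.Base using (Fin; toℕ)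
open import Data.Fin.Properties using (nonZeroIndex) renaming (_≟_ to _≟ꟳ_)
open import Data.List.Base using (List; []; _∷_; _++_; map; concatMap; foldr; upTo)
open import Data.Nat.Base using (ℕ; NonZero; _∸_) renaming (_+_ to _+ᴺ_; _*_ to _*ᴺ_)
open import Data.Nat.DivMod using (_/_; _mod_)
open import Data.Product using (_×_; _,_; ∃; ∃!; ∃₂)
open import Data.Product.Relation.Binary.Pointwise.NonDependent using (Pointwise)
open import Function.Base using (_∘_; id)
open import Function.Bundles using (Inverse; _⇔_)
open import Function.Definitions using (Bijective)
open import Relation.Binary.PropositionalEquality using (_≢_) renaming (setoid to ≡-setoid)
open import Relation.Nullary using (¬_; Dec; does)
open import Relation.Nullary.Decidable using (map′)
import Algebra.Properties.CommutativeMonoid.Sum as Sum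
import Algebra.Properties.Semiring.Exp as Exp
import Function.Endo.Propositional as Endo

-- A field with exactly q elements, together with an enumeration
-- c₀ , … , c_{q-1} of them.
record FiniteField (c r : Level) (q : ℕ) : Set (lsuc (c ⊔ r)) where
  field
    commutativeRing : CommutativeRing c r

  open CommutativeRing commutativeRing public

  field
    1≉0         : ¬ (1# ≈ 0#)
    invertible  : ∀ x → ¬ (x ≈ 0#) → ∃ λ y → x * y ≈ 1#
    enumeration : Inverse (≡-setoid (Fin q)) setoid

  infix 4 _≟_

  _≟_ : ∀ x y → Dec (x ≈ y)
  x ≟ y = map′ from-injective from-cong (from x ≟ꟳ from y)
    where
    open Inverse enumeration using (to; from; from-cong; to-cong; strictlyInverseˡ)
    from-injective = λ eq →
      trans (sym (strictlyInverseˡ x)) (trans (to-cong eq) (strictlyInverseˡ y))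

  -- The library's _mod_ turns a natural number into an index; it leaves
  -- numbers below q unchanged, and only such numbers are used below.
  elt : ℕ → Carrier
  elt n = Inverse.to enumeration (n mod q)
    where
    instance
      q≢0 : NonZero q
      q≢0 = nonZeroIndex (Inverse.from enumeration 0#)

module _ {c r q} (F : FiniteField c r q) where
  open FiniteField F
  open Sum +-commutativeMonoid using (sum)
  open Exp semiring using (_^_)

  -- Polynomials in X and Y of degree < q in each variable;
  -- f i j is the coefficient of Xⁱ Yʲ.
  Polynomial : Set c
  Polynomial = Fin q → Fin q → Carrier

  eval : Polynomial → Carrier → Carrier → Carrier
  eval f x y = sum λ i → sum λ j → f i j * (x ^ toℕ i * y ^ toℕ j)

  IsLPP : Polynomial → Set (c ⊔ r)
  IsLPP f = (∀ y₀ → Bijective _≈_ _≈_ (λ x → eval f x y₀))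
          × (∀ x₀ → Bijective _≈_ _≈_ (λ y → eval f x₀ y))

  Orthogonal : Polynomial → Polynomial → Set (c ⊔ r)
  Orthogonal f g = ∀ u v →
    ∃! (Pointwise _≈_ _≈_) λ (x , y) → eval f x y ≈ u × eval g x y ≈ v

  HasCompanion : Polynomial → Set (c ⊔ r)
  HasCompanion f = ∃ λ g → IsLPP g × Orthogonal f g

  Permutation : Set (c ⊔ r)
  Permutation = Inverse setoid setoid

  IsPermutationTuple : (Fin q → Permutation) → Set (c ⊔ r)
  IsPermutationTuple β = ∀ i j → i ≢ j →
    ∀ x → ¬ (Inverse.from (β i) (Inverse.to (β j) x) ≈ x)

  IsTupleOf : (Fin q → Permutation) → Polynomial → Set (c ⊔ r)
  IsTupleOf β f = IsPermutationTuple β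
    × (∀ i x → eval f x (Inverse.to (β i) x) ≈ Inverse.to enumeration i)

  -- The cycle with the given (pairwise distinct) entries: each entry goes to
  -- the next one, the last to the first, and all other elements are fixed.
  cycle : List Carrier → Carrier → Carrier
  cycle []       = id
  cycle (y ∷ ys) = next y ys
    where
    next : Carrier → List Carrier → Carrier → Carrier
    next z []       x = if does (x ≟ z) then y else x
    next z (w ∷ ws) x = if does (x ≟ z) then w else next w ws x

-- upTo n lists 0, …, n ∸ 1, so the index ranges below are
-- 0 ≤ m ≤ (k - 2)/2 and 0 ≤ n ≤ (k - 4)/2.  All subtractions and divisions
-- are exact when k is even and k ≥ 4; the entries of
-- C₁ and C₂ together are then the indices 0, …, 4k - 1, each occurring once.
C₁ C₂ : ℕ → List ℕ
C₁ k = concatMap (λ m → 2 *ᴺ m ∷ 2 *ᴺ (2 *ᴺ m +ᴺ k ∸ 1) ∷ [])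
               (upTo ((k ∸ 2) / 2 +ᴺ 1))
    ++ concatMap (λ n → 2 *ᴺ n +ᴺ k ∷ 2 *ᴺ (2 *ᴺ n +ᴺ k) ∷ [])
               (upTo ((k ∸ 4) / 2 +ᴺ 1))
    ++ 4 *ᴺ k ∸ 1 ∷ 4 *ᴺ k ∸ 4 ∷ []
C₂ k = concatMap (λ m → 2 *ᴺ m +ᴺ 1 ∷ 2 *ᴺ (2 *ᴺ m +ᴺ k) +ᴺ 1 ∷ [])
               (upTo ((k ∸ 2) / 2 +ᴺ 1))
    ++ concatMap (λ n → 2 *ᴺ n +ᴺ k +ᴺ 1 ∷ 2 *ᴺ (2 *ᴺ n +ᴺ k) ∸ 1 ∷ [])
               (upTo ((k ∸ 4) / 2 +ᴺ 1))
    ++ 4 *ᴺ k ∸ 2 ∷ 4 *ᴺ k ∸ 5 ∷ []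

module _ {c r} (k : ℕ) (F : FiniteField c r (4 *ᴺ k)) where
  open FiniteField F using (Carrier; _≈_; elt)
  open Endo Carrier using (_^_)

  a : Carrier → Carrier
  a = foldr _∘_ id
        (map (λ m → cycle F (elt (2 *ᴺ m) ∷ elt (2 *ᴺ m +ᴺ 1) ∷ []))
             (upTo (2 *ᴺ k)))

  b : Carrier → Carrier
  b = cycle F (map elt (C₁ k)) ∘ cycle F (map elt (C₂ k))

  infix 4 _∈G₁

  _∈G₁ : Permutation F → Set (c ⊔ r)
  σ ∈G₁ = ∃₂ λ (j : Fin (2 *ᴺ k)) (i : Fin 2) →
    ∀ x → Inverse.to σ x ≈ (b ^ toℕ j) ((a ^ toℕ i) x)

  ConsistsOfG₁ : (Fin (4 *ᴺ k) → Permutation F) → Set (c ⊔ r)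
  ConsistsOfG₁ β = ∀ σ →
    σ ∈G₁ ⇔ (∃ λ i → ∀ x → Inverse.to σ x ≈ Inverse.to (β i) x)

{-# OPTIONS --safe #-}
module Submission where

-- The entries of C₁ and C₂ give coordinates (s , t) ∈ ℤ₂ × ℤ₂ₖ on 𝔽_q in which
-- b (s , t) = (s , t + 1) and a (s , t) = (s + 1 , (k + 1) t).  So G₁ is regular,
-- with aba = bᵏ⁺¹.  For g = bʲaⁱ with 0 ≤ j < 2k let h = 1 if j ≥ k and h = 0
-- otherwise, e = i + h mod 2 and τ(g) = b^(2j+e) aʰ.  Both τ and
-- g ↦ τ(g)g⁻¹ = b^(j+e(1+kj)) aᵉ permute G₁, hence the function sending (x , g x) to
-- τ(g) x is a Latin square.  It is orthogonal to f, as x ↦ τ(g) x is a permutation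
-- for each g.  Interpolation turns it into a polynomial.

open import Defs
open import Algebra.Bundles using (CommutativeRing)
open import Data.Fin.Base using (Fin; zero; suc; toℕ)
open import Data.Fin.Properties
  using (0≢1+n; any?; nonZeroIndex; punchOut-injective; injective⇒≤; toℕ-fromℕ<;
    toℕ-injective; toℕ<n)
  renaming (_≟_ to _≟ꟳ_; suc-injective to suc-injectiveꟳ)
open import Data.Product using (∃; ∃₂; _×_; _,_; proj₁; proj₂)
open import Function.Base using (_∘_; id)
open import Function.Bundles using (Inverse; Equivalence)
open import Function.Definitions using (Bijective; Injective)
open import Level using (Level)
open import Relation.Binary.PropositionalEquality as ≡ using (_≡_; _≢_; cong; cong₂)
open import Relation.Nullary
import Relation.Binary.Reasoning.Setoid as SetoidReasoning

-- The shape of τ comes from doubling. On exponents modulo 2k the map j ↦ 2j is two-to-one, with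
-- fibres {j, j + k}. The bit h tells the two members of a fibre apart, and τ stores it in the
-- exponent of a. Doubling leaves the parity of the exponent of b free, and there τ stores e.
-- Storing e = i + h rather than i makes the quotient work: aʰa⁻ⁱ = aᵉ, so τ(g)g⁻¹ shows e as its
-- exponent of a. Its exponent of b is (1 + ek)j + e, and 1 + ek is a unit modulo 2k because k is
-- even. So e and j are recovered, then h, then i = e + h.
--
-- The obstacle is that h depends on the representative 0 ≤ j < 2k and not on the residue class
-- alone, so congruences must be turned into equalities of bounded exponents before h can be
-- compared. Most other arithmetic rests on one fact: kt modulo 2k depends only on the parity of t.
-- No abstract group is formed; words in a and b appear only through their action on coordinates.

module RingIdentities {c r} (R : CommutativeRing c r) where
  open import Data.Maybe.Base using (nothing)
  open import Tactic.RingSolver using () renaming (solve-∀ to solve-∀-in)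
  open import Tactic.RingSolver.Core.AlmostCommutativeRing
    using (AlmostCommutativeRing; fromCommutativeRing)

  private
    ring : AlmostCommutativeRing c r
    ring = fromCommutativeRing R λ _ → nothing

  open AlmostCommutativeRing ring

  x*yz≈y*xz : ∀ x y z → x * (y * z) ≈ y * (x * z)
  x*yz≈y*xz = solve-∀-in ring

  x*yz≈xz*y : ∀ x y z → x * (y * z) ≈ x * z * y
  x*yz≈xz*y = solve-∀-in ring

  linear-step : ∀ y a x e → y * a + x * (a + (x + y) * e) ≈ (x + y) * (a + x * e)
  linear-step = solve-∀-in ring

  x+[y+z]≈y+[z+x] : ∀ x y z → x + (y + z) ≈ y + (z + x)
  x+[y+z]≈y+[z+x] = solve-∀-in ring

-- Polynomial interpolation of functions in one and two variables

module Interpolation {c r q} (F : FiniteField c r q) where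
  open import Data.Nat.Base using (zero; suc)
  open import Data.Vec.Functional using (_∷_; head; tail)
  import Algebra.Properties.Group as GroupProperties
  import Algebra.Properties.Semiring.Exp as Exp
  import Algebra.Properties.Semiring.Sum as Sum

  open FiniteField F
  open Sum semiring using (sum; sum-cong-≋; *-distribˡ-sum; *-distribʳ-sum)
  open Exp semiring using (_^_; ^-congˡ)
  open GroupProperties +-group using (x∙y⁻¹≈ε⇒x≈y)
  open SetoidReasoning setoid
  open RingIdentities commutativeRing

  -- A plain power sum, in the shape of `eval`; Horner's recursion is `horner-step`.
  horner : ∀ {n} → (Fin n → Carrier) → Carrier → Carrier
  horner p x = sum λ i → p i * x ^ toℕ i

  horner-step : ∀ {n} (p : Fin (suc n) → Carrier) x →
    horner p x ≈ head p + x * horner (tail p) x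
  horner-step p x = +-cong (*-identityʳ (head p)) (begin
    sum (λ i → tail p i * (x * x ^ toℕ i))
      ≈⟨ sum-cong-≋ (λ i → x*yz≈y*xz (tail p i) x (x ^ toℕ i)) ⟩
    sum (λ i → x * (tail p i * x ^ toℕ i))
      ≈⟨ *-distribˡ-sum x (λ i → tail p i * x ^ toℕ i) ⟨
    x * horner (tail p) x ∎)

  horner-cong : ∀ {n} (p : Fin n → Carrier) {x y} → x ≈ y → horner p x ≈ horner p y
  horner-cong {n} p x≈y = sum-cong-≋ {n} λ i → *-congˡ {p i} (^-congˡ (toℕ i) x≈y)

  addConstant : ∀ {n} → Carrier → (Fin (suc n) → Carrier) → Fin (suc n) → Carrier
  addConstant a p = a + head p ∷ tail p

  horner-addConstant : ∀ {n} a (p : Fin (suc n) → Carrier) x →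
    horner (addConstant a p) x ≈ a + horner p x
  horner-addConstant a p x = begin
    horner (addConstant a p) x             ≈⟨ horner-step (addConstant a p) x ⟩
    a + head p + x * horner (tail p) x     ≈⟨ +-assoc a (head p) _ ⟩
    a + (head p + x * horner (tail p) x)   ≈⟨ +-congˡ (horner-step p x) ⟨
    a + horner p x                         ∎

  -- Coefficients of (X - b)p, from (X - b)(p₀ + Xp′) = -bp₀ + X(p₀ + (X - b)p′).
  mulLinear : ∀ {n} → Carrier → (Fin n → Carrier) → Fin (suc n) → Carrier
  mulLinear {zero}  b p = λ _ → 0#
  mulLinear {suc n} b p = - b * head p ∷ addConstant (head p) (mulLinear b (tail p))

  horner-mulLinear : ∀ {n} b (p : Fin n → Carrier) x →
    horner (mulLinear b p) x ≈ (x - b) * horner p x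
  horner-mulLinear {zero} b p x = begin
    0# * 1# + 0#   ≈⟨ trans (+-identityʳ _) (zeroˡ 1#) ⟩
    0#             ≈⟨ zeroʳ (x - b) ⟨
    (x - b) * 0#   ∎
  horner-mulLinear {suc n} b p x = begin
    horner (mulLinear b p) x
      ≈⟨ horner-step (mulLinear b p) x ⟩
    - b * head p + x * horner (addConstant (head p) (mulLinear b (tail p))) x
      ≈⟨ +-congˡ (*-congˡ (horner-addConstant (head p) (mulLinear b (tail p)) x)) ⟩
    - b * head p + x * (head p + horner (mulLinear b (tail p)) x)
      ≈⟨ +-congˡ (*-congˡ (+-congˡ (horner-mulLinear b (tail p) x))) ⟩
    - b * head p + x * (head p + (x - b) * horner (tail p) x)
      ≈⟨ linear-step (- b) (head p) x (horner (tail p) x) ⟩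
    (x - b) * (head p + x * horner (tail p) x)
      ≈⟨ *-congˡ (horner-step p x) ⟨
    (x - b) * horner p x ∎

  -- Newton's form: p(x) = v₀ + (x − b₀) p′(x), where p′ interpolates the
  -- divided differences at the remaining nodes.
  interpolate : ∀ {n} (nodes : Fin n → Carrier) →
    (∀ {i j} → nodes i ≈ nodes j → i ≡ j) →
    (v : Fin n → Carrier) → ∃ λ (p : Fin n → Carrier) → ∀ i → horner p (nodes i) ≈ v i
  interpolate {zero}  nodes distinct v = (λ ()) , λ ()
  interpolate {suc n} nodes distinct v = p , p-interpolates
    where
    x₀ = head nodes
    inverse : ∀ i → ∃ λ w → (tail nodes i - x₀) * w ≈ 1#
    inverse i = invertible (tail nodes i - x₀)
      λ eq → contradiction (≡.sym (distinct (x∙y⁻¹≈ε⇒x≈y (tail nodes i) x₀ eq))) 0≢1+n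
    rest : ∃ λ (p : Fin n → Carrier) → ∀ i →
      horner p (tail nodes i) ≈ proj₁ (inverse i) * (tail v i - head v)
    rest = interpolate (tail nodes) (suc-injectiveꟳ ∘ distinct) _
    p : Fin (suc n) → Carrier
    p = addConstant (head v) (mulLinear x₀ (proj₁ rest))
    p-value : ∀ x → horner p x ≈ head v + (x - x₀) * horner (proj₁ rest) x
    p-value x = trans (horner-addConstant (head v) (mulLinear x₀ (proj₁ rest)) x)
      (+-congˡ (horner-mulLinear x₀ (proj₁ rest) x))
    p-interpolates : ∀ i → horner p (nodes i) ≈ v i
    p-interpolates zero = begin
      horner p x₀
        ≈⟨ p-value x₀ ⟩
      head v + (x₀ - x₀) * horner (proj₁ rest) x₀
        ≈⟨ +-congˡ (trans (*-congʳ (-‿inverseʳ x₀)) (zeroˡ _)) ⟩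
      head v + 0#
        ≈⟨ +-identityʳ (head v) ⟩
      head v ∎
    p-interpolates (suc i) = begin
      horner p x
        ≈⟨ p-value x ⟩
      head v + (x - x₀) * horner (proj₁ rest) x
        ≈⟨ +-congˡ (*-congˡ (proj₂ rest i)) ⟩
      head v + (x - x₀) * (w * (v (suc i) - head v))
        ≈⟨ +-congˡ (*-assoc (x - x₀) w _) ⟨
      head v + (x - x₀) * w * (v (suc i) - head v)
        ≈⟨ +-congˡ (*-congʳ (proj₂ (inverse i))) ⟩
      head v + 1# * (v (suc i) - head v)
        ≈⟨ +-congˡ (*-identityˡ _) ⟩
      head v + (v (suc i) - head v)
        ≈⟨ x+[y+z]≈y+[z+x] (head v) (v (suc i)) (- head v) ⟩
      v (suc i) + (- head v + head v)
        ≈⟨ +-congˡ (-‿inverseˡ (head v)) ⟩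
      v (suc i) + 0#
        ≈⟨ +-identityʳ (v (suc i)) ⟩
      v (suc i) ∎
      where
      x w : Carrier
      x = nodes (suc i)
      w = proj₁ (inverse i)

  open Inverse enumeration using (to; from; to-cong; from-cong; strictlyInverseˡ; strictlyInverseʳ)

  to-injective : ∀ {i j} → to i ≈ to j → i ≡ j
  to-injective {i} {j} eq =
    ≡.trans (≡.sym (strictlyInverseʳ i)) (≡.trans (from-cong eq) (strictlyInverseʳ j))

  interpolate₁ : (h : Carrier → Carrier) → (∀ {x y} → x ≈ y → h x ≈ h y) →
    ∃ λ (p : Fin q → Carrier) → ∀ x → horner p x ≈ h x
  interpolate₁ h h-cong with p , eq ← interpolate to to-injective (h ∘ to) = p , λ x → begin
    horner p x              ≈⟨ horner-cong p (strictlyInverseˡ x) ⟨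
    horner p (to (from x))  ≈⟨ eq (from x) ⟩
    h (to (from x))         ≈⟨ h-cong (strictlyInverseˡ x) ⟩
    h x                     ∎

  -- For each fixed y the function is interpolated in X; each coefficient so obtained is a function
  -- of y, which is interpolated in turn.
  interpolate₂ : (h : Carrier → Carrier → Carrier) →
    (∀ {x x′ y y′} → x ≈ x′ → y ≈ y′ → h x y ≈ h x′ y′) →
    ∃ λ g → ∀ x y → eval F g x y ≈ h x y
  interpolate₂ h h-cong = g , λ x y → begin
    (sum λ i → sum λ j → g i j * (x ^ toℕ i * y ^ toℕ j))
      ≈⟨ sum-cong-≋ (λ i → sum-cong-≋ λ j → x*yz≈xz*y (g i j) (x ^ toℕ i) (y ^ toℕ j)) ⟩
    (sum λ i → sum λ j → g i j * y ^ toℕ j * x ^ toℕ i)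
      ≈⟨ sum-cong-≋ (λ i → *-distribʳ-sum (x ^ toℕ i) λ j → g i j * y ^ toℕ j) ⟨
    (sum λ i → horner (g i) y * x ^ toℕ i)
      ≈⟨ sum-cong-≋ (λ i → *-congʳ (g-value i y)) ⟩
    horner (proj₁ (column (from y))) x
      ≈⟨ proj₂ (column (from y)) x ⟩
    h x (to (from y))
      ≈⟨ h-cong refl (strictlyInverseˡ y) ⟩
    h x y ∎
    where
    column : ∀ j → ∃ λ (p : Fin q → Carrier) → ∀ x → horner p x ≈ h x (to j)
    column j = interpolate₁ (λ x → h x (to j)) λ x≈x′ → h-cong x≈x′ refl
    row : ∀ i → ∃ λ (p : Fin q → Carrier) → ∀ y → horner p y ≈ proj₁ (column (from y)) i
    -- Columns are indexed by `from y` and not by `y`: equal field elements then share literally the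
    -- same coefficients, which makes the coefficient a function that respects `≈`.
    row i = interpolate₁ (λ y → proj₁ (column (from y)) i)
      λ y≈y′ → reflexive (≡.cong (λ j → proj₁ (column j) i) (from-cong y≈y′))
    g : Polynomial F
    g i = proj₁ (row i)
    g-value : ∀ i y → horner (g i) y ≈ proj₁ (column (from y)) i
    g-value i = proj₂ (row i)

  eval-cong : ∀ f {x x′ y y′} → x ≈ x′ → y ≈ y′ → eval F f x y ≈ eval F f x′ y′
  eval-cong f x≈x′ y≈y′ = sum-cong-≋ {q} λ i → sum-cong-≋ {q} λ j →
    *-congˡ {f i j} (*-cong (^-congˡ (toℕ i) x≈x′) (^-congˡ (toℕ j) y≈y′))

open import Data.Bool.Base using (Bool; true; false; not; _xor_; if_then_else_)
open import Data.Bool.Properties using (not-involutive; xor-identityʳ)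
open import Data.Fin.Base using (punchOut)
open import Data.List.Base using (List; []; _∷_; _++_; foldr; map; concatMap; applyUpTo; upTo)
open import Data.List.Properties using (++-assoc; concatMap-map; map-upTo; map-applyUpTo)
open import Data.Nat.Base
  using (ℕ; zero; suc; _+_; _*_; _∸_; _^_; _≤_; _<_; z≤n; s≤s; NonZero)
open import Data.Nat.DivMod
import Data.Nat.Properties as ℕᵖ
open import Data.Nat.Tactic.RingSolver using (solve-∀)
import Function.Endo.Propositional as Endo
open import Relation.Binary.Bundles using (Setoid)
open import Relation.Nullary.Decidable using (dec-true; dec-false)

-- Congruences of natural numbers

module Congruences where
  open ℕᵖ
  open ≡ using (refl; sym; trans; subst; subst₂; module ≡-Reasoning)

  infix 4 _≋_[mod_]
  -- Multiples are allowed on both sides, so no subtraction occurs, symmetry is immediate and the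
  -- modulus may be zero.
  record _≋_[mod_] (x y n : ℕ) : Set where
    constructor multiples
    field
      c d   : ℕ
      equality : x + c * n ≡ y + d * n

  module _ {n : ℕ} where

    ≡⇒≋ : ∀ {x y} → x ≡ y → x ≋ y [mod n ]
    ≡⇒≋ refl = multiples 0 0 refl

    mod-sym : ∀ {x y} → x ≋ y [mod n ] → y ≋ x [mod n ]
    mod-sym (multiples c d eq) = multiples d c (sym eq)

    mod-trans : ∀ {x y z} → x ≋ y [mod n ] → y ≋ z [mod n ] → x ≋ z [mod n ]
    mod-trans {x} {y} {z} (multiples c d eq) (multiples c′ d′ eq′) =
      multiples (c + c′) (d + d′) (begin
        x + (c + c′) * n        ≡⟨ left x c c′ n ⟩
        (x + c * n) + c′ * n    ≡⟨ cong (_+ c′ * n) eq ⟩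
        (y + d * n) + c′ * n    ≡⟨ middle y d c′ n ⟩
        (y + c′ * n) + d * n    ≡⟨ cong (_+ d * n) eq′ ⟩
        (z + d′ * n) + d * n    ≡⟨ right z d d′ n ⟩
        z + (d + d′) * n        ∎)
      where
      open ≡-Reasoning
      left : ∀ x c c′ n → x + (c + c′) * n ≡ (x + c * n) + c′ * n
      left = solve-∀
      middle : ∀ y d c′ n → (y + d * n) + c′ * n ≡ (y + c′ * n) + d * n
      middle = solve-∀
      right : ∀ z d d′ n → (z + d′ * n) + d * n ≡ z + (d + d′) * n
      right = solve-∀

    modSetoid : Setoid _ _
    modSetoid = record
      { Carrier       = ℕ
      ; _≈_           = _≋_[mod n ]
      ; isEquivalence = record { refl = ≡⇒≋ refl ; sym = mod-sym ; trans = mod-trans }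
      }

    mod-+ : ∀ {x y x′ y′} → x ≋ y [mod n ] → x′ ≋ y′ [mod n ] → x + x′ ≋ y + y′ [mod n ]
    mod-+ {x} {y} {x′} {y′} (multiples c d eq) (multiples c′ d′ eq′) =
      multiples (c + c′) (d + d′)
        (trans (swap x x′ c c′ n) (trans (cong₂ _+_ eq eq′) (sym (swap y y′ d d′ n))))
      where
      swap : ∀ x x′ c c′ n → x + x′ + (c + c′) * n ≡ (x + c * n) + (x′ + c′ * n)
      swap = solve-∀

    mod-+ˡ : ∀ z {x y} → x ≋ y [mod n ] → z + x ≋ z + y [mod n ]
    mod-+ˡ z = mod-+ (≡⇒≋ refl)

    mod-+ʳ : ∀ z {x y} → x ≋ y [mod n ] → x + z ≋ y + z [mod n ]
    mod-+ʳ z x≡y = mod-+ x≡y (≡⇒≋ refl)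

    mod-*ˡ : ∀ z {x y} → x ≋ y [mod n ] → z * x ≋ z * y [mod n ]
    mod-*ˡ z {x} {y} (multiples c d eq) = multiples (z * c) (z * d)
      (trans (factor z x c n) (trans (cong (z *_) eq) (sym (factor z y d n))))
      where
      factor : ∀ z x c n → z * x + z * c * n ≡ z * (x + c * n)
      factor = solve-∀

    mod-+-cancelˡ : ∀ z {x y} → z + x ≋ z + y [mod n ] → x ≋ y [mod n ]
    mod-+-cancelˡ z {x} {y} (multiples c d eq) = multiples c d
      (+-cancelˡ-≡ z _ _ (trans (sym (+-assoc z x (c * n))) (trans eq (+-assoc z y (d * n)))))

    mod-+-cancelʳ : ∀ z {x y} → x + z ≋ y + z [mod n ] → x ≋ y [mod n ]
    mod-+-cancelʳ z {x} {y} eq =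
      mod-+-cancelˡ z (subst₂ (_≋_[mod n ]) (+-comm x z) (+-comm y z) eq)

    mod-drop : ∀ x c → x + c * n ≋ x [mod n ]
    mod-drop x c = multiples 0 c (+-identityʳ _)

    module _ .{{_ : NonZero n}} where

      mod⇒% : ∀ {x y} → x ≋ y [mod n ] → x % n ≡ y % n
      mod⇒% {x} {y} (multiples c d eq) =
        trans (sym ([m+kn]%n≡m%n x c n)) (trans (cong (_% n) eq) ([m+kn]%n≡m%n y d n))

      mod-% : ∀ x → x ≋ x % n [mod n ]
      mod-% x = multiples 0 (x / n) (trans (+-identityʳ x) (m≡m%n+[m/n]*n x n))

      %⇒mod : ∀ {x y} → x % n ≡ y % n → x ≋ y [mod n ]
      %⇒mod {x} {y} eq = mod-trans (mod-% x) (mod-trans (≡⇒≋ eq) (mod-sym (mod-% y)))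

      mod-unique : ∀ {x y} → x < n → y < n → x ≋ y [mod n ] → x ≡ y
      mod-unique x<n y<n eq =
        trans (sym (m<n⇒m%n≡m x<n)) (trans (mod⇒% eq) (m<n⇒m%n≡m y<n))

  mod-weaken : ∀ {x y} n m → x ≋ y [mod n * m ] → x ≋ y [mod n ]
  mod-weaken {x} {y} n m (multiples c d eq) = multiples (c * m) (d * m)
    (trans (reassoc x c n m) (trans eq (sym (reassoc y d n m))))
    where
    reassoc : ∀ x c n m → x + c * m * n ≡ x + c * (n * m)
    reassoc = solve-∀

  -- With n = 2 this says that the parity of x determines kx modulo 2k, the fact behind all
  -- computations with `twist`.
  mod-scale : ∀ k {x y n} → x ≋ y [mod n ] → k * x ≋ k * y [mod n * k ]
  mod-scale k {x} {y} {n} (multiples c d eq) = multiples c d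
    (trans (factor k x c n) (trans (cong (k *_) eq) (sym (factor k y d n))))
    where
    factor : ∀ k x c n → k * x + c * (n * k) ≡ k * (x + c * n)
    factor = solve-∀

  mod-unscale : ∀ k .{{_ : NonZero k}} {x y n} → k * x ≋ k * y [mod k * n ] → x ≋ y [mod n ]
  mod-unscale k {x} {y} {n} (multiples c d eq) = multiples c d
    (*-cancelˡ-≡ _ _ k (trans (sym (factor k x c n)) (trans eq (factor k y d n))))
    where
    factor : ∀ k x c n → k * x + c * (k * n) ≡ k * (x + c * n)
    factor = solve-∀

  bit : Bool → ℕ
  bit false = 0
  bit true  = 1

  bit<2 : ∀ s → bit s < 2
  bit<2 false = s≤s z≤n
  bit<2 true  = s≤s (s≤s z≤n)

  bit-injective : ∀ {s s′} → bit s ≡ bit s′ → s ≡ s′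
  bit-injective {false} {false} _ = refl
  bit-injective {true}  {true}  _ = refl

  xor-parity : ∀ i h → bit h ≋ bit i + bit (i xor h) [mod 2 ]
  xor-parity false false = ≡⇒≋ refl
  xor-parity false true  = ≡⇒≋ refl
  xor-parity true  false = multiples 1 0 refl
  xor-parity true  true  = ≡⇒≋ refl

  xor-cancelˡ : ∀ i {h h′} → i xor h ≡ i xor h′ → h ≡ h′
  xor-cancelˡ false eq = eq
  xor-cancelˡ true {false} {false} _ = refl
  xor-cancelˡ true {true} {true} _ = refl

  xor-cancelʳ : ∀ i {h h′} → h xor i ≡ h′ xor i → h ≡ h′
  xor-cancelʳ i {false} {false} _ = refl
  xor-cancelʳ i {true}  {true}  _ = refl
  xor-cancelʳ false {false} {true} ()
  xor-cancelʳ true {false} {true} ()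
  xor-cancelʳ false {true} {false} ()
  xor-cancelʳ true {true} {false} ()

  bit-mod-injective : ∀ {s s′} → bit s ≋ bit s′ [mod 2 ] → s ≡ s′
  bit-mod-injective {s} {s′} eq = bit-injective (mod-unique (bit<2 s) (bit<2 s′) eq)

  -- The complete mapping in coordinates

  module Twist (m : ℕ) where
    k n : ℕ
    k = 2 * m
    n = 2 * k

    -- In the coordinates of Action.point, aⁱ maps (s , t) to (s xor i , twist i t).
    twist : Bool → ℕ → ℕ
    twist i t = t + bit i * (k * t)

    private



      drop-even : ∀ x e t → x + e * (k * t) ≋ x [mod 2 ]
      drop-even x e t =
        mod-trans (≡⇒≋ (move x e m t)) (mod-drop x (e * m * t))
        where
        move : ∀ x e m t → x + e * (2 * m * t) ≡ x + e * m * t * 2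
        move = solve-∀

    twist-parity : ∀ i t → twist i t ≋ t [mod 2 ]
    twist-parity i t = drop-even t (bit i) t

    twist-cong : ∀ i {t t′} → t ≋ t′ [mod n ] → twist i t ≋ twist i t′ [mod n ]
    twist-cong i t≡t′ = mod-+ t≡t′ (mod-*ˡ (bit i) (mod-*ˡ k t≡t′))

    -- Since k is even, `twist` preserves parity. Thus t and t′ have equal parity, so the summands
    -- kt and kt′ agree modulo 2k and cancel.
    twist-injective : ∀ i {t t′} → twist i t ≋ twist i t′ [mod n ] → t ≋ t′ [mod n ]
    twist-injective i {t} {t′} eq = mod-+-cancelʳ (bit i * (k * t)) (begin
      t + bit i * (k * t)    ≈⟨ eq ⟩
      t′ + bit i * (k * t′)  ≈⟨ mod-+ˡ t′ (mod-*ˡ (bit i) (mod-scale k t≡t′[2])) ⟨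
      t′ + bit i * (k * t)   ∎)
      where
      open SetoidReasoning (modSetoid {n})
      t≡t′[2] : t ≋ t′ [mod 2 ]
      t≡t′[2] = mod-trans (mod-sym (twist-parity i t))
        (mod-trans (mod-weaken 2 k eq) (twist-parity i t′))

    half : ℕ → Bool
    half j = does (k ≤? j)

    half-remainder : ∀ {j} → j < n → ∃ λ u → j ≡ u + bit (half j) * k × u < k
    half-remainder {j} j<n = remainder (k ≤? j)
      where
      remainder : (d : Dec (k ≤ j)) → ∃ λ u → j ≡ u + bit (does d) * k × u < k
      remainder (yes k≤j) = j ∸ k
        , trans (sym (m∸n+n≡m k≤j)) (cong (j ∸ k +_) (sym (+-identityʳ k)))
        , subst (j ∸ k <_) (trans (m+n∸m≡n k (k + 0)) (+-identityʳ k)) (∸-monoˡ-< j<n k≤j)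
      remainder (no k≰j) = j , sym (+-identityʳ j) , ≰⇒> k≰j

    half-injective : .{{_ : NonZero k}} → ∀ {j j′} → j < n → j′ < n →
      half j ≡ half j′ → j ≋ j′ [mod k ] → j ≡ j′
    half-injective {j} {j′} j<n j′<n h≡h′ j≡j′
      with u , eq , u<k ← half-remainder j<n
         | u′ , eq′ , u′<k ← half-remainder j′<n = begin
      j                      ≡⟨ eq ⟩
      u + bit (half j) * k   ≡⟨ cong₂ (λ u h → u + bit h * k) (mod-unique u<k u′<k u≡u′) h≡h′ ⟩
      u′ + bit (half j′) * k ≡⟨ eq′ ⟨
      j′                     ∎
      where
      open ≡-Reasoning
      reduce : ∀ {j u} h → j ≡ u + bit h * k → j ≋ u [mod k ]
      reduce {u = u} h eq = mod-trans (≡⇒≋ eq) (mod-drop u (bit h))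
      u≡u′ : u ≋ u′ [mod k ]
      u≡u′ = mod-trans (mod-sym (reduce (half j) eq)) (mod-trans j≡j′ (reduce (half j′) eq′))

    -- The complete mapping sends bʲaⁱ to b^(shift i j) a^(half j).
    shift : Bool → ℕ → ℕ
    shift i j = bit (i xor half j) + 2 * j

    module _ .{{_ : NonZero k}} {i i′ : Bool} {j j′ : ℕ} (j<n : j < n) (j′<n : j′ < n) where

      -- The parity of the exponent reveals e, and with the known h also i. Removing e and halving
      -- leaves j modulo k, and h selects one of its two lifts below 2k.
      shift-injective : half j ≡ half j′ → shift i j ≋ shift i′ j′ [mod n ] → i ≡ i′ × j ≡ j′
      shift-injective h≡h′ eq = i≡i′ , half-injective j<n j′<n h≡h′ j≡j′[k]
        where
        parity : ∀ i j → shift i j ≋ bit (i xor half j) [mod 2 ]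
        parity i j = mod-trans (≡⇒≋ (cong (bit (i xor half j) +_) (*-comm 2 j))) (mod-drop _ j)
        e≡e′ : i xor half j ≡ i′ xor half j′
        e≡e′ = bit-mod-injective (mod-trans (mod-sym (parity i j))
          (mod-trans (mod-weaken 2 k eq) (parity i′ j′)))
        i≡i′ : i ≡ i′
        i≡i′ = xor-cancelʳ (half j′) (subst (λ h → i xor h ≡ _) h≡h′ e≡e′)
        j≡j′[k] : j ≋ j′ [mod k ]
        j≡j′[k] = mod-unscale 2 (mod-+-cancelˡ (bit (i xor half j))
          (subst (λ e → shift i j ≋ bit e + 2 * j′ [mod n ]) (sym e≡e′) eq))

    private
      -- Since h ≡ i + e modulo 2, the twist by h is the twist by i followed by that by e.
      transfer : ∀ i j t {t′} → t′ ≋ twist i t + j [mod n ] → let e = i xor half j in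
        twist (half j) t + shift i j ≋ t′ + (bit e + (j + bit e * (k * t))) [mod n ]
      transfer i j t {t′} t′≡ = begin
        t + bit h * (k * t) + (bit e + 2 * j)
          ≈⟨ mod-+ʳ _ (mod-+ˡ t h-twist) ⟩
        t + (bit i * (k * t) + bit e * (k * t)) + (bit e + 2 * j)
          ≡⟨ regroup t (bit i * (k * t)) (bit e * (k * t)) (bit e) j ⟩
        -- Applying τ(g)g⁻¹ at position t′ gives the correction ek(t′ + j); as t′ + j and t have the
        -- same parity, it equals ekt modulo 2k.
        twist i t + j + (bit e + (j + bit e * (k * t)))
          ≈⟨ mod-+ʳ _ t′≡ ⟨
        t′ + (bit e + (j + bit e * (k * t))) ∎
        where
        open SetoidReasoning (modSetoid {n})
        h e : Bool
        h = half j
        e = i xor h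
        commute : ∀ k t b → k * (t * b) ≡ b * (k * t)
        commute = solve-∀
        expand : ∀ k t b c → k * (t * (b + c)) ≡ b * (k * t) + c * (k * t)
        expand = solve-∀
        regroup : ∀ t x y z j → t + (x + y) + (z + 2 * j) ≡ t + x + j + (z + (j + y))
        regroup = solve-∀
        h-twist : bit h * (k * t) ≋ bit i * (k * t) + bit e * (k * t) [mod n ]
        h-twist = subst₂ (_≋_[mod n ]) (commute k t (bit h)) (expand k t (bit i) (bit e))
          (mod-scale k (mod-*ˡ t (xor-parity i h)))

    module _ .{{_ : NonZero k}} .{{_ : NonZero n}} {i i′ : Bool} {j j′ t t′ : ℕ}
      (j<n : j < n) (j′<n : j′ < n) where

      -- Parity comes first. Modulo 2 the terms with factor k vanish, so `sums` gives j ≡ j′ and the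
      -- common target then gives t ≡ t′. Hence kt and kt′ agree modulo 2k, and `sums` now yields j
      -- = j′. This fixes h, then i through e, and untwisting the target gives t modulo 2k.
      column-injective : twist i t + j ≋ twist i′ t′ + j′ [mod n ] →
        i xor half j ≡ i′ xor half j′ →
        twist (half j) t + shift i j ≋ twist (half j′) t′ + shift i′ j′ [mod n ] →
        i ≡ i′ × t ≋ t′ [mod n ]
      column-injective target e≡e′ image = i≡i′ , t≡t′
        where
        e : Bool
        e = i xor half j
        sums : j + bit e * (k * t) ≋ j′ + bit e * (k * t′) [mod n ]
        sums = mod-+-cancelˡ (bit e) (mod-+-cancelˡ (twist i t + j)
          (mod-trans (mod-sym (transfer i j t (≡⇒≋ refl)))
            (mod-trans image (subst
              (λ f → _ ≋ twist i t + j + (bit f + (j′ + bit f * (k * t′))) [mod n ])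
              (sym e≡e′) (transfer i′ j′ t′ target)))))
        j≡j′[2] : j ≋ j′ [mod 2 ]
        j≡j′[2] = mod-trans (mod-sym (drop-even j (bit e) t))
          (mod-trans (mod-weaken 2 k sums) (drop-even j′ (bit e) t′))
        t≡t′[2] : t ≋ t′ [mod 2 ]
        t≡t′[2] = mod-+-cancelʳ j (mod-trans (mod-+ʳ j (mod-sym (twist-parity i t)))
          (mod-trans (mod-weaken 2 k target) (mod-+ (twist-parity i′ t′) (mod-sym j≡j′[2]))))
        j≡j′ : j ≡ j′
        j≡j′ = mod-unique j<n j′<n (mod-+-cancelʳ (bit e * (k * t)) (mod-trans sums
          (mod-+ˡ j′ (mod-*ˡ (bit e) (mod-sym (mod-scale k t≡t′[2]))))))
        i≡i′ : i ≡ i′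
        i≡i′ = xor-cancelʳ (half j′) (subst (λ j → i xor half j ≡ _) j≡j′ e≡e′)
        t≡t′ : t ≋ t′ [mod n ]
        t≡t′ = twist-injective i′ (mod-+-cancelʳ j′
          (subst₂ (λ i j → twist i t + j ≋ twist i′ t′ + j′ [mod n ]) i≡i′ j≡j′ target))

open Congruences

-- The entries of C₁ and C₂ as explicit sequences

module CycleEntries where
  open ℕᵖ
  open ≡ using (refl; sym; trans; subst; subst₂; module ≡-Reasoning)

  [e+v*n]%n≡e : ∀ {n} .{{_ : NonZero n}} {e} v → e < n → (e + v * n) % n ≡ e
  [e+v*n]%n≡e {n} {e} v e<n = trans ([m+kn]%n≡m%n e v n) (m<n⇒m%n≡m e<n)

  [e+v*n]/n≡v : ∀ {n} .{{_ : NonZero n}} {e} v → e < n → (e + v * n) / n ≡ v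
  [e+v*n]/n≡v {n} {e} v e<n = *-cancelʳ-≡ _ v n (+-cancelˡ-≡ ((e + v * n) % n) _ _
    (trans (sym (m≡m%n+[m/n]*n (e + v * n) n)) (cong (_+ v * n) (sym ([e+v*n]%n≡e v e<n)))))

  e+v*n<m*n : ∀ {e n v m} → e < n → v < m → e + v * n < m * n
  e+v*n<m*n {n = n} {v} e<n v<m = <-≤-trans (+-monoˡ-< (v * n) e<n) (*-monoˡ-≤ n v<m)

  module _ {A : Set} where

    concatMap-upTo-suc : ∀ (f : ℕ → List A) n →
      concatMap f (upTo (suc n)) ≡ f 0 ++ concatMap (f ∘ suc) (upTo n)
    concatMap-upTo-suc f n = cong (f 0 ++_)
      (trans (cong (concatMap f) (sym (map-upTo suc n))) (concatMap-map f suc (upTo n)))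

    -- Needed to join the m pairs, the m - 1 pairs and the final pair of a cycle into a single range
    -- of k pairs, where m = k/2.
    concatMap-upTo-+ : ∀ (f : ℕ → List A) a b →
      concatMap f (upTo (a + b)) ≡ concatMap f (upTo a) ++ concatMap (λ v → f (a + v)) (upTo b)
    concatMap-upTo-+ f zero    b = refl
    concatMap-upTo-+ f (suc a) b = begin
      concatMap f (upTo (suc a + b))
        ≡⟨ concatMap-upTo-suc f (a + b) ⟩
      f 0 ++ concatMap (f ∘ suc) (upTo (a + b))
        ≡⟨ cong (f 0 ++_) (concatMap-upTo-+ (f ∘ suc) a b) ⟩
      f 0 ++ (concatMap (f ∘ suc) (upTo a) ++ concatMap (λ v → f (suc a + v)) (upTo b))
        ≡⟨ ++-assoc (f 0) _ _ ⟨
      (f 0 ++ concatMap (f ∘ suc) (upTo a)) ++ concatMap (λ v → f (suc a + v)) (upTo b)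
        ≡⟨ cong (_++ concatMap (λ v → f (suc a + v)) (upTo b)) (concatMap-upTo-suc f a) ⟨
      concatMap f (upTo (suc a)) ++ concatMap (λ v → f (suc a + v)) (upTo b) ∎
      where open ≡-Reasoning

    concatMap-upTo-cong : ∀ {f g : ℕ → List A} n → (∀ {u} → u < n → f u ≡ g u) →
      concatMap f (upTo n) ≡ concatMap g (upTo n)
    concatMap-upTo-cong zero f≡g = refl
    concatMap-upTo-cong {f} {g} (suc n) f≡g = trans (concatMap-upTo-suc f n)
      (trans (cong₂ _++_ (f≡g (s≤s z≤n)) (concatMap-upTo-cong n (f≡g ∘ s≤s)))
        (sym (concatMap-upTo-suc g n)))

    concatMap-pairs : ∀ (G : ℕ → A) n →
      concatMap (λ u → G (u * 2) ∷ G (1 + u * 2) ∷ []) (upTo n) ≡ applyUpTo G (n * 2)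
    concatMap-pairs G zero    = refl
    concatMap-pairs G (suc n) = trans (concatMap-upTo-suc (λ u → G (u * 2) ∷ G (1 + u * 2) ∷ []) n)
      (cong (λ xs → G 0 ∷ G 1 ∷ xs) (concatMap-pairs (λ t → G (2 + t)) n))

  module Positions (w : ℕ) where
    m k l : ℕ
    m = 2 + w
    k = 2 * m
    l = k ∸ 1

    m<k : m < k
    m<k = m<m+n m (s≤s z≤n)

    -- The t-th entry, counted from 0, of the cycle C₁ (s = false) or C₂ (s = true).
    entry : Bool → ℕ → ℕ
    entry s t = choose (t % 2) (t / 2)
      where
      choose : ℕ → ℕ → ℕ
      choose zero    u = if does (u <? l) then bit s + u * 2 else l * 2 + (bit (not s) + m * 4)
      choose (suc _) u = l * 2 + (if does (u <? m) then 3 * bit s + u * 4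
                                  else 1 + bit (not s) + (u ∸ m) * 4)

    entry-low : ∀ s {u} → u < l → entry s (u * 2) ≡ bit s + u * 2
    entry-low s {u} u<l
      rewrite [e+v*n]%n≡e {2} {{_}} {0} u (s≤s z≤n)
            | [e+v*n]/n≡v {2} {{_}} {0} u (s≤s z≤n)
            | dec-true (u <? l) u<l = refl

    entry-top : ∀ s → entry s (l * 2) ≡ l * 2 + (bit (not s) + m * 4)
    entry-top s
      rewrite [e+v*n]%n≡e {2} {{_}} {0} l (s≤s z≤n)
            | [e+v*n]/n≡v {2} {{_}} {0} l (s≤s z≤n)
            | dec-false (l <? l) (n≮n l) = refl

    entry-mid : ∀ s {u} → u < m → entry s (1 + u * 2) ≡ l * 2 + (3 * bit s + u * 4)
    entry-mid s {u} u<m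
      rewrite [e+v*n]%n≡e {2} {{_}} {1} u (s≤s (s≤s z≤n))
            | [e+v*n]/n≡v {2} {{_}} {1} u (s≤s (s≤s z≤n))
            | dec-true (u <? m) u<m = refl

    entry-high : ∀ s v → entry s (1 + (m + v) * 2) ≡ l * 2 + (1 + bit (not s) + v * 4)
    entry-high s v
      rewrite [e+v*n]%n≡e {2} {{_}} {1} (m + v) (s≤s (s≤s z≤n))
            | [e+v*n]/n≡v {2} {{_}} {1} (m + v) (s≤s (s≤s z≤n))
            | dec-false (m + v <? m) (m+n≮m m v) | m+n∸m≡n m v = refl

    -- Even positions are `low` except for the last one, `top`, whose entry breaks the arithmetic
    -- progression. Odd positions fall into two halves of length m, each with entries in steps of 4.
    data Position : ℕ → Set where
      low  : ∀ {u} → u < l → Position (u * 2)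
      top  : Position (l * 2)
      mid  : ∀ {u} → u < m → Position (1 + u * 2)
      high : ∀ {v} → v < m → Position (1 + (m + v) * 2)

    position : ∀ {t} → t < k * 2 → Position t
    position {t} t<2k =
      subst Position (sym (m≡m%n+[m/n]*n t 2))
        (classify (t % 2) (m%n<n t 2) (t / 2) (m<n*o⇒m/o<n t<2k))
      where
      classify : ∀ r → r < 2 → ∀ u → u < k → Position (r + u * 2)
      classify 0 _ u u<k with u <? l
      ... | yes u<l = low u<l
      ... | no  u≮l = subst (λ u → Position (u * 2)) (≤-antisym (≮⇒≥ u≮l) (≤-pred u<k)) top
      classify 1 _ u u<k with u <? m
      ... | yes u<m = mid u<m
      ... | no  u≮m = subst (λ u → Position (1 + u * 2)) (m+[n∸m]≡n (≮⇒≥ u≮m))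
        (high (subst (u ∸ m <_) (trans (m+n∸m≡n m (m + 0)) (+-identityʳ m))
          (∸-monoˡ-< u<k (≮⇒≥ u≮m))))
      classify (suc (suc _)) (s≤s (s≤s ()))

    private
      lower upper : ℕ → ℕ → Bool × ℕ
      lower zero    u = false , u * 2
      lower (suc _) u = true , u * 2
      upper 0 v = if does (v <? m) then (false , 1 + v * 2) else (true , l * 2)
      upper 1 v = if does (v <? m) then (true , 1 + (m + v) * 2) else (false , l * 2)
      upper 2 v = false , 1 + (m + v) * 2
      upper _ v = true , 1 + v * 2

    -- Left inverse of `entry`. Below 2k - 2 the parity of the index is the side. Above it, the
    -- offset modulo 4 separates the `mid` and `high` entries of the two cycles; the two `top`
    -- entries lie in classes 0 and 1 and are recognised by the quotient m, one past the regular
    -- range.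
    decode : ℕ → Bool × ℕ
    decode x = if does (x <? l * 2) then lower (x % 2) (x / 2)
               else upper ((x ∸ l * 2) % 4) ((x ∸ l * 2) / 4)

    private
      decode-lower : ∀ {d u} → d < 2 → u < l → decode (d + u * 2) ≡ lower d u
      decode-lower {d} {u} d<2 u<l
        rewrite dec-true (d + u * 2 <? l * 2) (e+v*n<m*n d<2 u<l)
              | [e+v*n]%n≡e u d<2 | [e+v*n]/n≡v u d<2 = refl

      decode-upper : ∀ {d} v → d < 4 → decode (l * 2 + (d + v * 4)) ≡ upper d v
      decode-upper {d} v d<4
        rewrite dec-false (l * 2 + (d + v * 4) <? l * 2) (m+n≮m (l * 2) (d + v * 4))
              | m+n∸m≡n (l * 2) (d + v * 4) | [e+v*n]%n≡e v d<4 | [e+v*n]/n≡v v d<4 = refl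

      upper-top : ∀ s → upper (bit (not s)) m ≡ (s , l * 2)
      upper-top false rewrite dec-false (m <? m) (n≮n m) = refl
      upper-top true  rewrite dec-false (m <? m) (n≮n m) = refl

      upper-mid : ∀ s {u} → u < m → upper (3 * bit s) u ≡ (s , 1 + u * 2)
      upper-mid false {u} u<m rewrite dec-true (u <? m) u<m = refl
      upper-mid true  u<m = refl

      upper-high : ∀ s {v} → v < m → upper (1 + bit (not s)) v ≡ (s , 1 + (m + v) * 2)
      upper-high false v<m = refl
      upper-high true {v} v<m rewrite dec-true (v <? m) v<m = refl

      3*bit<4 : ∀ s → 3 * bit s < 4
      3*bit<4 false = s≤s z≤n
      3*bit<4 true  = n<1+n 3

      1+bit<4 : ∀ s → 1 + bit s < 4
      1+bit<4 s = m<n⇒m<1+n (s≤s (bit<2 s))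

      bit<4 : ∀ s → bit s < 4
      bit<4 s = m<n⇒m<1+n (m<n⇒m<1+n (bit<2 s))

    decode-entry : ∀ s {t} → t < k * 2 → decode (entry s t) ≡ (s , t)
    decode-entry s t<2k = decode-at s (position t<2k)
      where
      decode-at : ∀ s {t} → Position t → decode (entry s t) ≡ (s , t)
      decode-at false (low u<l) =
        trans (cong decode (entry-low false u<l)) (decode-lower (bit<2 false) u<l)
      decode-at true  (low u<l) =
        trans (cong decode (entry-low true u<l)) (decode-lower (bit<2 true) u<l)
      decode-at s top = trans (cong decode (entry-top s))
        (trans (decode-upper m (bit<4 (not s))) (upper-top s))
      decode-at s (mid {u} u<m) = trans (cong decode (entry-mid s u<m))
        (trans (decode-upper u (3*bit<4 s)) (upper-mid s u<m))
      decode-at s (high {v} v<m) = trans (cong decode (entry-high s v))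
        (trans (decode-upper v (1+bit<4 (not s))) (upper-high s v<m))

    entry-injective : ∀ {s s′ t t′} → t < k * 2 → t′ < k * 2 → entry s t ≡ entry s′ t′ →
      s ≡ s′ × t ≡ t′
    entry-injective {s} {s′} t< t′< eq = cong proj₁ pairs , cong proj₂ pairs
      where
      pairs = trans (sym (decode-entry s t<)) (trans (cong decode eq) (decode-entry s′ t′<))

    private
      4k≡l*2+2+m*4 : 4 * k ≡ l * 2 + (2 + m * 4)
      4k≡l*2+2+m*4 = expand w
        where
        -- The factor `1 + (w + (2 + (w + 0)))` is the normal form of `l`, written out so that the
        -- ring solver meets no `∸`. The later identities use the same form.
        expand : ∀ w → 4 * (2 * (2 + w)) ≡ (1 + (w + (2 + (w + 0)))) * 2 + (2 + (2 + w) * 4)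
        expand = solve-∀

      upper-bound : ∀ {d v} → d + v * 4 < 2 + m * 4 → l * 2 + (d + v * 4) < 4 * k
      upper-bound {d} {v} d+4v< =
        subst (l * 2 + (d + v * 4) <_) (sym 4k≡l*2+2+m*4) (+-monoʳ-< (l * 2) d+4v<)

    entry< : ∀ s {t} → t < k * 2 → entry s t < 4 * k
    entry< s t<2k = bound (position t<2k)
      where
      bound : ∀ {t} → Position t → entry s t < 4 * k
      bound (low {u} u<l) = subst (_< 4 * k) (sym (entry-low s u<l))
        (<-≤-trans (e+v*n<m*n (bit<2 s) u<l)
          (≤-trans (m≤m+n (l * 2) _) (≤-reflexive (sym 4k≡l*2+2+m*4))))
      bound top = subst (_< 4 * k) (sym (entry-top s))
        (upper-bound {v = m} (+-monoˡ-< (m * 4) (bit<2 (not s))))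
      bound (mid {u} u<m) = subst (_< 4 * k) (sym (entry-mid s u<m))
        (upper-bound {v = u} (<-≤-trans (e+v*n<m*n (3*bit<4 s) u<m) (m≤n+m (m * 4) 2)))
      bound (high {v} v<m) = subst (_< 4 * k) (sym (entry-high s v))
        (upper-bound {v = v} (<-≤-trans (e+v*n<m*n (1+bit<4 (not s)) v<m) (m≤n+m (m * 4) 2)))

    n : ℕ
    n = 2 * k

    private
      even-position : ∀ u k → u * 2 + u * (2 * k) ≡ u * 2 + k * (u * 2) + 0
      even-position = solve-∀

      mid-pair : ∀ l b u → l * 2 + (3 * b + u * 4) ≡ 2 * (l + b + u * 2) + b
      mid-pair = solve-∀

      high-pair : ∀ s u → l * 2 + (1 + bit s + u * 4) ≡ 2 * (l + bit s + u * 2) + bit (not s)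
      high-pair s u = trans (cong (λ b → l * 2 + (b + u * 4)) (complement s))
        (regroup l (bit s) (bit (not s)) u)
        where
        complement : ∀ s → 1 + bit s ≡ 2 * bit s + bit (not s)
        complement false = refl
        complement true  = refl
        regroup : ∀ l b b̄ u → l * 2 + (2 * b + b̄ + u * 4) ≡ 2 * (l + b + u * 2) + b̄
        regroup = solve-∀

    -- a swaps c₂ᵥ and c₂ᵥ₊₁, hence the t-th entry of one cycle and the (k + 1)t-th of the other.
    entry-pair : ∀ s {t} → t < k * 2 → ∃₂ λ v r → ∃ λ t′ →
      t′ < k * 2 × t′ ≋ t + k * t [mod n ] ×
      entry s t ≡ 2 * v + bit r × entry (not s) t′ ≡ 2 * v + bit (not r)
    entry-pair s t<2k = pair s (position t<2k)
      where
      pair : ∀ s {t} → Position t → ∃₂ λ v r → ∃ λ t′ →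
        t′ < k * 2 × t′ ≋ t + k * t [mod n ] ×
        entry s t ≡ 2 * v + bit r × entry (not s) t′ ≡ 2 * v + bit (not r)
      -- For even t the term kt is a multiple of 2k, so the partner sits at the same position of the
      -- other cycle.
      pair s (low {u} u<l) = u , s , u * 2 , *-monoˡ-< 2 (m<n⇒m<1+n u<l)
        , multiples u 0 (even-position u k)
        , trans (entry-low s u<l) (commute (bit s) u)
        , trans (entry-low (not s) u<l) (commute (bit (not s)) u)
        where
        commute : ∀ b u → b + u * 2 ≡ 2 * u + b
        commute = solve-∀
      -- The `top` entries are 4k - 1 in C₁ and 4k - 2 in C₂, so parity and side are opposite here.
      pair s top = l + m * 2 , not s , l * 2 , *-monoˡ-< 2 (n<1+n l)
        , multiples l 0 (even-position l k)
        , trans (entry-top s) (regroup l m (bit (not s)))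
        , trans (entry-top (not s)) (regroup l m (bit (not (not s))))
        where
        regroup : ∀ l m b → l * 2 + (b + m * 4) ≡ 2 * (l + m * 2) + b
        regroup = solve-∀
      -- For odd t the position moves by k = 2m, which exchanges `mid` and `high`.
      pair s (mid {u} u<m) = l + bit s + u * 2 , s , 1 + (m + u) * 2
        , e+v*n<m*n (n<1+n 1) (+-monoʳ-< m (subst (u <_) (sym (+-identityʳ m)) u<m))
        , multiples u 0 (odd-position u m)
        , trans (entry-mid s u<m) (mid-pair l (bit s) u)
        , trans (entry-high (not s) u) (trans
            (cong (λ r → l * 2 + (1 + bit r + u * 4)) (not-involutive s)) (high-pair s u))
        where
        odd-position : ∀ u m → 1 + (m + u) * 2 + u * (2 * (2 * m)) ≡
          1 + u * 2 + 2 * m * (1 + u * 2) + 0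
        odd-position = solve-∀
      pair s (high {v} v<m) = l + bit (not s) + v * 2 , s , 1 + v * 2
        , e+v*n<m*n (n<1+n 1) (<-trans v<m m<k)
        , multiples (1 + m + v) 0 (odd-position v m)
        , trans (entry-high s v) (trans (high-pair (not s) v)
            (cong (λ r → 2 * (l + bit (not s) + v * 2) + bit r) (not-involutive s)))
        , trans (entry-mid (not s) v<m) (mid-pair l (bit (not s)) v)
        where
        odd-position : ∀ v m → 1 + v * 2 + (1 + m + v) * (2 * (2 * m)) ≡
          1 + (m + v) * 2 + 2 * m * (1 + (m + v) * 2) + 0
        odd-position = solve-∀

    private
      k≡m+1+w+1 : k ≡ m + (suc w + 1)
      k≡m+1+w+1 = identity w
        where
        identity : ∀ w → 2 * (2 + w) ≡ 2 + w + (1 + w + 1)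
        identity = solve-∀

      first-length : (k ∸ 2) / 2 + 1 ≡ m
      first-length = trans (cong (λ x → x / 2 + 1) (identity w))
        (trans (cong (_+ 1) (m*n/n≡m (1 + w) 2)) (+-comm (1 + w) 1))
        where
        identity : ∀ w → w + (2 + (w + 0)) ≡ (1 + w) * 2
        identity = solve-∀

      second-length : (k ∸ 4) / 2 + 1 ≡ suc w
      second-length = trans (cong (λ x → (x ∸ 2) / 2 + 1) (identity w))
        (trans (cong (λ x → x / 2 + 1) (m+n∸n≡m (w * 2) 2))
          (trans (cong (_+ 1) (m*n/n≡m w 2)) (+-comm w 1)))
        where
        identity : ∀ w → w + (2 + (w + 0)) ≡ w * 2 + 2
        identity = solve-∀

      m<l : m < l
      m<l = subst (suc m ≤_) (identity w) (m≤m+n (suc m) w)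
        where
        identity : ∀ w → 1 + (2 + w) + w ≡ 1 + (w + (2 + (w + 0)))
        identity = solve-∀

      m+v<l : ∀ {v} → v < suc w → m + v < l
      m+v<l {v} v<1+w = subst (m + v <_) (identity w) (+-monoʳ-< m v<1+w)
        where
        identity : ∀ w → 2 + w + (1 + w) ≡ 1 + (w + (2 + (w + 0)))
        identity = solve-∀

      m+1+w≡l : m + (suc w + 0) ≡ l
      m+1+w≡l = identity w
        where
        identity : ∀ w → 2 + w + (1 + w + 0) ≡ 1 + (w + (2 + (w + 0)))
        identity = solve-∀

      -- One argument serves both cycles. In the final pair, `y` continues the progression of the
      -- second block at v = m - 1, while `x` is the irregular `top` entry.
      entries : ∀ s (f g : ℕ → List ℕ) (x y : ℕ) →
        (∀ {u} → u < m → f u ≡ bit s + u * 2 ∷ l * 2 + (3 * bit s + u * 4) ∷ []) →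
        (∀ {v} → v < suc w → g v ≡ bit s + (m + v) * 2 ∷ l * 2 + (1 + bit (not s) + v * 4) ∷ []) →
        x ≡ l * 2 + (bit (not s) + m * 4) → y ≡ l * 2 + (1 + bit (not s) + suc w * 4) →
        concatMap f (upTo ((k ∸ 2) / 2 + 1)) ++ concatMap g (upTo ((k ∸ 4) / 2 + 1)) ++ x ∷ y ∷ []
          ≡ applyUpTo (entry s) (k * 2)
      entries s f g x y f≡ g≡ x≡ y≡ = begin
        concatMap f (upTo ((k ∸ 2) / 2 + 1)) ++ concatMap g (upTo ((k ∸ 4) / 2 + 1)) ++ x ∷ y ∷ []
          ≡⟨ cong₂ (λ a b → concatMap f (upTo a) ++ concatMap g (upTo b) ++ x ∷ y ∷ [])
               first-length second-length ⟩
        concatMap f (upTo m) ++ concatMap g (upTo (suc w)) ++ x ∷ y ∷ []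
          ≡⟨ cong₂ _++_ (concatMap-upTo-cong m first)
               (cong₂ _++_ (concatMap-upTo-cong (suc w) second) last) ⟩
        concatMap pair (upTo m) ++ concatMap (λ v → pair (m + v)) (upTo (suc w))
          ++ concatMap (λ v → pair (m + (suc w + v))) (upTo 1)
          ≡⟨ cong (concatMap pair (upTo m) ++_) (concatMap-upTo-+ (λ v → pair (m + v)) (suc w) 1) ⟨
        concatMap pair (upTo m) ++ concatMap (λ v → pair (m + v)) (upTo (suc w + 1))
          ≡⟨ concatMap-upTo-+ pair m (suc w + 1) ⟨
        concatMap pair (upTo (m + (suc w + 1)))
          ≡⟨ cong (λ a → concatMap pair (upTo a)) k≡m+1+w+1 ⟨
        concatMap pair (upTo k)
          ≡⟨ concatMap-pairs (entry s) k ⟩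
        applyUpTo (entry s) (k * 2) ∎
        where
        open ≡-Reasoning
        pair : ℕ → List ℕ
        pair u = entry s (u * 2) ∷ entry s (1 + u * 2) ∷ []
        first : ∀ {u} → u < m → f u ≡ pair u
        first u<m = trans (f≡ u<m) (sym
          (cong₂ (λ x y → x ∷ y ∷ []) (entry-low s (<-trans u<m m<l)) (entry-mid s u<m)))
        second : ∀ {v} → v < suc w → g v ≡ pair (m + v)
        second {v} v<1+w = trans (g≡ v<1+w) (sym
          (cong₂ (λ x y → x ∷ y ∷ []) (entry-low s (m+v<l v<1+w)) (entry-high s v)))
        last : x ∷ y ∷ [] ≡ pair (m + (suc w + 0))
        last = cong₂ (λ x y → x ∷ y ∷ [])
          (trans x≡ (trans (sym (entry-top s)) (cong (λ u → entry s (u * 2)) (sym m+1+w≡l))))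
          (trans y≡ (trans (sym (entry-high s (suc w)))
            (cong (λ v → entry s (1 + (m + v) * 2)) (sym (+-identityʳ (suc w))))))

    C₁-entries : C₁ k ≡ applyUpTo (entry false) (k * 2)
    C₁-entries = entries false _ _ _ _
      (λ {u} _ → cong₂ (λ x y → x ∷ y ∷ []) (*-comm 2 u)
        (trans (cong (2 *_) (+-∸-assoc (2 * u) {k} {1} (s≤s z≤n))) (odd-first u l)))
      (λ {v} _ → cong₂ (λ x y → x ∷ y ∷ []) (even-second v m) (odd-second v w))
      (cong (_∸ 1) (four-k₁ w)) (cong (_∸ 4) (four-k₄ w))
      where
      odd-first : ∀ u l → 2 * (2 * u + l) ≡ l * 2 + (0 + u * 4)
      odd-first = solve-∀
      even-second : ∀ v m → 2 * v + 2 * m ≡ 0 + (m + v) * 2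
      even-second = solve-∀
      odd-second : ∀ v w → 2 * (2 * v + 2 * (2 + w)) ≡ (1 + (w + (2 + (w + 0)))) * 2 + (2 + v * 4)
      odd-second = solve-∀
      four-k₁ : ∀ w → 4 * (2 * (2 + w)) ≡ 1 + ((1 + (w + (2 + (w + 0)))) * 2 + (1 + (2 + w) * 4))
      four-k₁ = solve-∀
      four-k₄ : ∀ w → 4 * (2 * (2 + w)) ≡ 4 + ((1 + (w + (2 + (w + 0)))) * 2 + (2 + (1 + w) * 4))
      four-k₄ = solve-∀

    C₂-entries : C₂ k ≡ applyUpTo (entry true) (k * 2)
    C₂-entries = entries true _ _ _ _
      (λ {u} _ → cong₂ (λ x y → x ∷ y ∷ []) (even-first u) (odd-first u w))
      (λ {v} _ → cong₂ (λ x y → x ∷ y ∷ []) (even-second v m) (cong (_∸ 1) (odd-second v w)))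
      (cong (_∸ 2) (four-k₂ w)) (cong (_∸ 5) (four-k₅ w))
      where
      even-first : ∀ u → 2 * u + 1 ≡ 1 + u * 2
      even-first = solve-∀
      odd-first : ∀ u w → 2 * (2 * u + 2 * (2 + w)) + 1 ≡
        (1 + (w + (2 + (w + 0)))) * 2 + (3 + u * 4)
      odd-first = solve-∀
      even-second : ∀ v m → 2 * v + 2 * m + 1 ≡ 1 + (m + v) * 2
      even-second = solve-∀
      odd-second : ∀ v w → 2 * (2 * v + 2 * (2 + w)) ≡
        1 + ((1 + (w + (2 + (w + 0)))) * 2 + (1 + v * 4))
      odd-second = solve-∀
      four-k₂ : ∀ w → 4 * (2 * (2 + w)) ≡ 2 + ((1 + (w + (2 + (w + 0)))) * 2 + (0 + (2 + w) * 4))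
      four-k₂ = solve-∀
      four-k₅ : ∀ w → 4 * (2 * (2 + w)) ≡ 5 + ((1 + (w + (2 + (w + 0)))) * 2 + (1 + (1 + w) * 4))
      four-k₅ = solve-∀

open CycleEntries

-- Counting on finite sets, and the values of cycles and transpositions

injective⇒surjective : ∀ {n} {f : Fin n → Fin n} → (∀ {i j} → f i ≡ f j → i ≡ j) →
  ∀ j → ∃ λ i → f i ≡ j
injective⇒surjective {suc n} {f} f-injective j with any? (λ i → f i ≟ꟳ j)
... | yes found = found
-- If j were missed, punching it out would embed `Fin (suc n)` into `Fin n`.
... | no ¬found = contradiction (injective⇒≤ avoid-injective) ℕᵖ.1+n≰n
  where
  j≢f : ∀ i → j ≢ f i
  j≢f i j≡fi = ¬found (i , ≡.sym j≡fi)
  avoid-injective : Injective _≡_ _≡_ (λ i → punchOut (j≢f i))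
  avoid-injective = f-injective ∘ punchOut-injective (j≢f _) (j≢f _)

module Cycles {c r q} (F : FiniteField c r q) where
  open ℕᵖ using (+-comm; +-cancelʳ-≡; *-comm; *-cancelˡ-≡; +-identityʳ; suc-injective; 1+n≢0)
  open FiniteField F using (Carrier; _≈_; 0#; refl; sym; trans; _≟_; elt; enumeration)
  open Inverse enumeration using (to; from; to-cong; from-cong; strictlyInverseˡ; strictlyInverseʳ)

  injective⇒bijective : ∀ {h : Carrier → Carrier} → (∀ {x y} → x ≈ y → h x ≈ h y) →
    Injective _≈_ _≈_ h → Bijective _≈_ _≈_ h
  injective⇒bijective {h} h-cong h-injective = h-injective , λ y →
    let i , eq = injective⇒surjective {f = from ∘ h ∘ to} index-injective (from y) in
    to i , λ z≈toi → trans (h-cong z≈toi) (from-injective eq)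
    where
    from-injective : Injective _≈_ _≡_ from
    from-injective {x} {y} eq =
      trans (sym (strictlyInverseˡ x)) (trans (to-cong eq) (strictlyInverseˡ y))
    index-injective : ∀ {i j} → from (h (to i)) ≡ from (h (to j)) → i ≡ j
    index-injective {i} {j} eq = ≡.trans (≡.sym (strictlyInverseʳ i))
      (≡.trans (from-cong (h-injective (from-injective eq))) (strictlyInverseʳ j))

  elt-injective : ∀ {i j} → i < q → j < q → elt i ≈ elt j → i ≡ j
  elt-injective {i} {j} i<q j<q eq = begin
    i              ≡⟨ m<n⇒m%n≡m i<q ⟨
    i % q          ≡⟨ toℕ-fromℕ< _ ⟨
    toℕ (i mod q)  ≡⟨ cong toℕ i≡j ⟩
    toℕ (j mod q)  ≡⟨ toℕ-fromℕ< _ ⟩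
    j % q          ≡⟨ m<n⇒m%n≡m j<q ⟩
    j              ∎
    where
    open ≡.≡-Reasoning
    instance
      q≢0 : NonZero q
      q≢0 = nonZeroIndex (from 0#)
    i≡j : i mod q ≡ j mod q
    i≡j = ≡.trans (≡.sym (strictlyInverseʳ _)) (≡.trans (from-cong eq) (strictlyInverseʳ _))

  cycle-head : ∀ {y z x} ws → x ≈ y → cycle F (y ∷ z ∷ ws) x ≡ z
  cycle-head {y} {z} {x} ws x≈y rewrite dec-true (x ≟ y) x≈y = ≡.refl

  cycle-second : ∀ {y z w x} ws → ¬ x ≈ y → x ≈ z → cycle F (y ∷ z ∷ w ∷ ws) x ≡ w
  cycle-second {y} {z} {w} {x} ws x≉y x≈z
    rewrite dec-false (x ≟ y) x≉y | dec-true (x ≟ z) x≈z = ≡.refl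

  cycle-close : ∀ {y z x} → ¬ x ≈ y → x ≈ z → cycle F (y ∷ z ∷ []) x ≡ y
  cycle-close {y} {z} {x} x≉y x≈z
    rewrite dec-false (x ≟ y) x≉y | dec-true (x ≟ z) x≈z = ≡.refl

  cycle-singleton : ∀ {y x} → ¬ x ≈ y → cycle F (y ∷ []) x ≡ x
  cycle-singleton {y} {x} x≉y rewrite dec-false (x ≟ y) x≉y = ≡.refl

  -- The head y is needed at the end to close the cycle, so recursion deletes the second entry
  -- instead. This keeps every statement about `cycle` itself and never about its local function
  -- `next`.
  cycle-skip : ∀ {y z x} ws → ¬ x ≈ y → ¬ x ≈ z →
    cycle F (y ∷ z ∷ ws) x ≡ cycle F (y ∷ ws) x
  cycle-skip {y} {z} {x} [] x≉y x≉z
    rewrite dec-false (x ≟ y) x≉y | dec-false (x ≟ z) x≉z = ≡.refl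
  cycle-skip {y} {z} {x} (w ∷ ws) x≉y x≉z
    rewrite dec-false (x ≟ y) x≉y | dec-false (x ≟ z) x≉z = ≡.refl

  module _ {y x : Carrier} (x≉y : ¬ x ≈ y) where

    cycle-tail-inner : ∀ (Q : ℕ → Carrier) {n} t → (∀ {i} → i < t → ¬ x ≈ Q i) → x ≈ Q t →
      suc t < n → cycle F (y ∷ applyUpTo Q n) x ≡ Q (suc t)
    cycle-tail-inner Q {suc (suc n)} zero x≉Q x≈Qt (s≤s (s≤s _)) =
      cycle-second (applyUpTo (λ i → Q (2 + i)) n) x≉y x≈Qt
    cycle-tail-inner Q {suc n} (suc t) x≉Q x≈Qt (s≤s 1+t<n) =
      ≡.trans (cycle-skip (applyUpTo (Q ∘ suc) n) x≉y (x≉Q (s≤s z≤n)))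
        (cycle-tail-inner (Q ∘ suc) t (x≉Q ∘ s≤s) x≈Qt 1+t<n)

    cycle-tail-last : ∀ (Q : ℕ → Carrier) t → (∀ {i} → i < t → ¬ x ≈ Q i) → x ≈ Q t →
      cycle F (y ∷ applyUpTo Q (suc t)) x ≡ y
    cycle-tail-last Q zero x≉Q x≈Qt = cycle-close x≉y x≈Qt
    cycle-tail-last Q (suc t) x≉Q x≈Qt =
      ≡.trans (cycle-skip (applyUpTo (Q ∘ suc) (suc t)) x≉y (x≉Q (s≤s z≤n)))
        (cycle-tail-last (Q ∘ suc) t (x≉Q ∘ s≤s) x≈Qt)

    cycle-tail-outside : ∀ (Q : ℕ → Carrier) n → (∀ {i} → i < n → ¬ x ≈ Q i) →
      cycle F (y ∷ applyUpTo Q n) x ≡ x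
    cycle-tail-outside Q zero x≉Q = cycle-singleton x≉y
    cycle-tail-outside Q (suc n) x≉Q =
      ≡.trans (cycle-skip (applyUpTo (Q ∘ suc) n) x≉y (x≉Q (s≤s z≤n)))
        (cycle-tail-outside (Q ∘ suc) n (x≉Q ∘ s≤s))

  cycle-outside : ∀ (P : ℕ → Carrier) n {x} → (∀ {i} → i < n → ¬ x ≈ P i) →
    cycle F (applyUpTo P n) x ≡ x
  cycle-outside P zero    x≉P = ≡.refl
  cycle-outside P (suc n) x≉P = cycle-tail-outside (x≉P (s≤s z≤n)) (P ∘ suc) n (x≉P ∘ s≤s)

  cycle-inner : ∀ (P : ℕ → Carrier) {n x} t → (∀ {i} → i < t → ¬ x ≈ P i) → x ≈ P t →
    suc t < n → cycle F (applyUpTo P n) x ≡ P (suc t)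
  cycle-inner P {suc (suc n)} zero x≉P x≈Pt (s≤s (s≤s _)) =
    cycle-head (applyUpTo (λ i → P (2 + i)) n) x≈Pt
  cycle-inner P (suc t) x≉P x≈Pt (s≤s 1+t<n) =
    cycle-tail-inner (x≉P (s≤s z≤n)) (P ∘ suc) t (x≉P ∘ s≤s) x≈Pt 1+t<n

  cycle-last : ∀ (P : ℕ → Carrier) {x} t → (∀ {i} → i < t → ¬ x ≈ P i) → x ≈ P t →
    cycle F (applyUpTo P (suc t)) x ≡ P 0
  cycle-last P {x} zero x≉P x≈P0 rewrite dec-true (x ≟ P 0) x≈P0 = ≡.refl
  cycle-last P (suc t) x≉P x≈Pt =
    cycle-tail-last (x≉P (s≤s z≤n)) (P ∘ suc) t (x≉P ∘ s≤s) x≈Pt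

  transposition : ℕ → Carrier → Carrier
  transposition v = cycle F (elt (2 * v) ∷ elt (2 * v + 1) ∷ [])

  transpositions : List ℕ → Carrier → Carrier
  transpositions vs = foldr _∘_ id (map (λ v → transposition v) vs)

  module _ {N : ℕ} (2N≤q : ∀ {v s} → v < N → 2 * v + bit s < q) where

    private
      pair-injective : ∀ {u v s s′} → u < N → v < N →
        elt (2 * u + bit s) ≈ elt (2 * v + bit s′) → u ≡ v × s ≡ s′
      pair-injective {u} {v} {s} {s′} u<N v<N eq =
        *-cancelˡ-≡ u v 2 (+-cancelʳ-≡ (bit s′) _ _ (≡.subst (λ s → 2 * u + bit s ≡ _) s≡s′ eq′))
        , s≡s′
        where
        eq′ : 2 * u + bit s ≡ 2 * v + bit s′
        eq′ = elt-injective (2N≤q {u} {s} u<N) (2N≤q {v} {s′} v<N) eq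
        reduce : ∀ v s → 2 * v + bit s ≋ bit s [mod 2 ]
        reduce v s = mod-trans
          (≡⇒≋ (≡.trans (+-comm (2 * v) (bit s)) (cong (bit s +_) (*-comm 2 v))))
          (mod-drop (bit s) v)
        s≡s′ : s ≡ s′
        s≡s′ = bit-mod-injective (mod-trans (mod-sym (reduce u s))
          (mod-trans (≡⇒≋ eq′) (reduce v s′)))

      at-first : ∀ v {x} → x ≈ elt (2 * v) → x ≈ elt (2 * v + bit false)
      at-first v {x} = ≡.subst (λ e → x ≈ elt e) (≡.sym (+-identityʳ (2 * v)))

    transposition-swap : ∀ {v} s {x} → v < N → x ≈ elt (2 * v + bit s) →
      transposition v x ≡ elt (2 * v + bit (not s))
    transposition-swap {v} false {x} v<N x≈ =
      cycle-head {elt (2 * v)} {elt (2 * v + 1)} []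
        (≡.subst (λ e → x ≈ elt e) (+-identityʳ (2 * v)) x≈)
    transposition-swap {v} true {x} v<N x≈ =
      ≡.trans (cycle-close {elt (2 * v)} {elt (2 * v + 1)} x≉ x≈)
        (cong elt (≡.sym (+-identityʳ (2 * v))))
      where
      x≉ : ¬ x ≈ elt (2 * v)
      x≉ eq = contradiction (proj₂ (pair-injective {v} {v} {true} {false} v<N v<N
        (trans (sym x≈) (at-first v eq)))) λ ()

    transposition-fix : ∀ {u v} s {x} → u < N → v < N → u ≢ v → x ≈ elt (2 * v + bit s) →
      transposition u x ≡ x
    transposition-fix {u} {v} s {x} u<N v<N u≢v x≈ =
      ≡.trans (cycle-skip {elt (2 * u)} {elt (2 * u + 1)} [] (x≉ false ∘ at-first u) (x≉ true))
        (cycle-singleton {elt (2 * u)} (x≉ false ∘ at-first u))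
      where
      x≉ : ∀ s′ → ¬ x ≈ elt (2 * u + bit s′)
      x≉ s′ eq = u≢v (proj₁ (pair-injective {u} {v} {s′} {s} u<N v<N (trans (sym eq) x≈)))

    module _ {v : ℕ} (s : Bool) (v<N : v < N) where

      transpositions-fix : ∀ (g : ℕ → ℕ) n {x} → (∀ {i} → i < n → g i < N) →
        (∀ {i} → i < n → g i ≢ v) → x ≈ elt (2 * v + bit s) →
        transpositions (applyUpTo g n) x ≡ x
      transpositions-fix g zero    g<N g≢v x≈ = ≡.refl
      transpositions-fix g (suc n) g<N g≢v x≈ =
        ≡.trans (cong (transposition (g 0))
            (transpositions-fix (g ∘ suc) n (g<N ∘ s≤s) (g≢v ∘ s≤s) x≈))
          (transposition-fix s (g<N (s≤s z≤n)) v<N (g≢v (s≤s z≤n)) x≈)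

      -- Only the transposition with index v moves x, and the image stays in the pair of v, which
      -- the others fix. A general sequence g is needed because the tail of `upTo` is not again of
      -- that form.
      transpositions-swap : ∀ (g : ℕ → ℕ) {n i x} → (∀ {j} → j < n → g j < N) →
        i < n → g i ≡ v → (∀ {j} → j < n → g j ≡ v → j ≡ i) → x ≈ elt (2 * v + bit s) →
        transpositions (applyUpTo g n) x ≡ elt (2 * v + bit (not s))
      transpositions-swap g {suc n} {zero} g<N _ g0≡v unique x≈ =
        ≡.trans (cong (transposition (g 0))
            (transpositions-fix (g ∘ suc) n (g<N ∘ s≤s) (λ j<n → 1+n≢0 ∘ unique (s≤s j<n)) x≈))
          (≡.trans (cong (λ u → transposition u _) g0≡v) (transposition-swap s v<N x≈))
      transpositions-swap g {suc n} {suc i} g<N (s≤s i<n) gi≡v unique x≈ =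
        ≡.trans (cong (transposition (g 0))
            (transpositions-swap (g ∘ suc) (g<N ∘ s≤s) i<n gi≡v
              (λ j<n → suc-injective ∘ unique (s≤s j<n)) x≈))
          (transposition-fix (not s) (g<N (s≤s z≤n)) v<N
            (λ g0≡v → 1+n≢0 (≡.sym (unique (s≤s z≤n) g0≡v))) refl)

-- Coordinates on the field and the action of a and b

module Action {c r} (w : ℕ) (F : FiniteField c r (4 * Positions.k w)) where
  open ℕᵖ using (*-comm; +-identityʳ; +-suc; <-irrefl; <-trans; ≤∧≢⇒<; _≟_; *-cancelˡ-<;
    ≤-<-trans; m≤m+n)
  open FiniteField F using (Carrier; _≈_; refl; sym; trans; reflexive; elt; enumeration)
  open Inverse enumeration using (to; from; to-cong; from-cong; strictlyInverseˡ; strictlyInverseʳ)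
  open Positions w
  open Twist m
    using (twist; twist-cong; twist-injective; half; shift; shift-injective; column-injective)
  open Cycles F
  open Endo Carrier using () renaming (_^_ to _^ᶠ_)

  private
    <n⇒<k*2 : ∀ {t} → t < n → t < k * 2
    <n⇒<k*2 {t} = ≡.subst (t <_) (*-comm 2 k)

    <k*2⇒<n : ∀ {t} → t < k * 2 → t < n
    <k*2⇒<n {t} = ≡.subst (t <_) (*-comm k 2)

  -- With a transparent point, unification would compute residues modulo 2k.
  abstract
    point : Bool → ℕ → Carrier
    point s t = elt (entry s (t % n))

    point-cong : ∀ s {t t′} → t ≋ t′ [mod n ] → point s t ≡ point s t′
    point-cong s t≋t′ = cong (λ t → elt (entry s t)) (mod⇒% t≋t′)

    point-entry : ∀ s {t} → t < n → point s t ≡ elt (entry s t)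
    point-entry s t<n = cong (λ t → elt (entry s t)) (m<n⇒m%n≡m t<n)

    entry-elt-injective : ∀ {s s′ t t′} → t < n → t′ < n →
      elt (entry s t) ≈ elt (entry s′ t′) → s ≡ s′ × t ≡ t′
    entry-elt-injective {s} {s′} t<n t′<n eq = entry-injective (<n⇒<k*2 t<n) (<n⇒<k*2 t′<n)
      (elt-injective (entry< s (<n⇒<k*2 t<n)) (entry< s′ (<n⇒<k*2 t′<n)) eq)

    point-injective : ∀ {s s′ t t′} → point s t ≈ point s′ t′ → s ≡ s′ × t ≋ t′ [mod n ]
    point-injective {t = t} {t′} eq =
      let s≡s′ , eq′ = entry-elt-injective (m%n<n t n) (m%n<n t′ n) eq in s≡s′ , %⇒mod eq′

    -- There are as many coordinate pairs as elements: j < 4k encodes the side j mod 2 and the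
    -- position j / 2, and `slot` is injective. The statement is about indices so that the
    -- coordinates chosen for equal elements are identical.
    point-surjective : ∀ i → ∃₂ λ s t → to i ≈ point s t
    point-surjective i =
      let j , eq = injective⇒surjective {f = from ∘ slot} slot-injective i in
      side j , pos j , trans (sym (trans (sym (strictlyInverseˡ (slot j))) (to-cong eq)))
        (reflexive (≡.sym (point-entry (side j) (pos< j))))
      where
      bit-of : ∀ {e} → e < 2 → ∃ λ s → bit s ≡ e
      bit-of {0} _ = false , ≡.refl
      bit-of {1} _ = true , ≡.refl
      bit-of {suc (suc _)} (s≤s (s≤s ()))
      side : Fin (4 * k) → Bool
      side j = proj₁ (bit-of (m%n<n (toℕ j) 2))
      pos : Fin (4 * k) → ℕ
      pos j = toℕ j / 2
      pos< : ∀ j → pos j < n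
      pos< j = m<n*o⇒m/o<n (≡.subst (toℕ j <_) (identity k) (toℕ<n j))
        where
        identity : ∀ k → 4 * k ≡ 2 * k * 2
        identity = solve-∀
      slot : Fin (4 * k) → Carrier
      slot j = elt (entry (side j) (pos j))
      slot-injective : ∀ {j j′} → from (slot j) ≡ from (slot j′) → j ≡ j′
      slot-injective {j} {j′} eq = toℕ-injective (begin
        toℕ j                          ≡⟨ m≡m%n+[m/n]*n (toℕ j) 2 ⟩
        toℕ j % 2 + pos j * 2          ≡⟨ cong (_+ pos j * 2) (proj₂ (bit-of (m%n<n (toℕ j) 2))) ⟨
        bit (side j) + pos j * 2       ≡⟨ cong₂ (λ s t → bit s + t * 2) (proj₁ eqs) (proj₂ eqs) ⟩
        bit (side j′) + pos j′ * 2     ≡⟨ cong (_+ pos j′ * 2) (proj₂ (bit-of (m%n<n (toℕ j′) 2))) ⟩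
        toℕ j′ % 2 + pos j′ * 2        ≡⟨ m≡m%n+[m/n]*n (toℕ j′) 2 ⟨
        toℕ j′                         ∎)
        where
        open ≡.≡-Reasoning
        eqs : side j ≡ side j′ × pos j ≡ pos j′
        eqs = entry-elt-injective (pos< j) (pos< j′)
          (trans (sym (strictlyInverseˡ (slot j)))
            (trans (to-cong eq) (strictlyInverseˡ (slot j′))))

    private
      rotation : Bool → Carrier → Carrier
      rotation s = cycle F (applyUpTo (elt ∘ entry s) n)

      entry-apart : ∀ {s s′ t i x} → x ≈ elt (entry s t) → t < n → i < n → ¬ (s ≡ s′ × t ≡ i) →
        ¬ x ≈ elt (entry s′ i)
      entry-apart x≈ t<n i<n apart x≈′ = apart (entry-elt-injective t<n i<n (trans (sym x≈) x≈′))

      rotation-step : ∀ s {t x} → t < n → x ≈ elt (entry s t) → rotation s x ≡ point s (suc t)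
      rotation-step s {t} {x} t<n x≈ = step (suc t ≟ n)
        where
        before : ∀ {i} → i < t → ¬ x ≈ elt (entry s i)
        before i<t = entry-apart x≈ t<n (<-trans i<t t<n) λ eq → <-irrefl (≡.sym (proj₂ eq)) i<t
        step : Dec (suc t ≡ n) → rotation s x ≡ point s (suc t)
        step (no 1+t≢n) = ≡.trans
          (cycle-inner (elt ∘ entry s) t before x≈ (≤∧≢⇒< t<n 1+t≢n))
          (≡.sym (point-entry s (≤∧≢⇒< t<n 1+t≢n)))
        -- At the last position the cycle closes to entry 0, which is where `point` sends n.
        step (yes 1+t≡n) = ≡.trans
          (cong (λ N → cycle F (applyUpTo (elt ∘ entry s) N) x) (≡.sym 1+t≡n))
          (≡.trans (cycle-last (elt ∘ entry s) t before x≈)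
            (cong (λ t → elt (entry s t)) (≡.sym (≡.trans (%-congˡ {o = n} 1+t≡n) (n%n≡0 n)))))

      rotation-fix : ∀ s {s′ t x} → s′ ≢ s → t < n → x ≈ elt (entry s′ t) → rotation s x ≡ x
      rotation-fix s s′≢s t<n x≈ = cycle-outside (elt ∘ entry s) n
        λ i<n → entry-apart x≈ t<n i<n (s′≢s ∘ proj₁)

      b≡rotations : ∀ x → b k F x ≡ rotation false (rotation true x)
      b≡rotations x = cong₂ (λ C C′ → cycle F C (cycle F C′ x))
        (entries false C₁-entries) (entries true C₂-entries)
        where
        entries : ∀ s {C} → C ≡ applyUpTo (entry s) (k * 2) →
          map elt C ≡ applyUpTo (elt ∘ entry s) n
        entries s eq = ≡.trans (cong (map elt) eq) (≡.trans (map-applyUpTo (entry s) elt (k * 2))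
          (cong (applyUpTo (elt ∘ entry s)) (*-comm k 2)))

    b-point : ∀ s t {x} → x ≈ point s t → b k F x ≈ point s (suc t)
    b-point s t {x} x≈ = reflexive (≡.trans (b≡rotations x) (≡.trans (rotate s x≈) (point-cong s
      (mod-+ˡ 1 (mod-sym (mod-% t))))))
      where
      t% : ℕ
      t% = t % n
      rotate : ∀ s → x ≈ point s t → rotation false (rotation true x) ≡ point s (suc t%)
      rotate false x≈ = ≡.trans
        (cong (rotation false) (rotation-fix true (λ ()) (m%n<n t n) x≈))
        (rotation-step false (m%n<n t n) x≈)
      rotate true x≈ = ≡.trans
        (rotation-fix false (λ ()) (m%n<n (suc t%) n)
          (reflexive (rotation-step true (m%n<n t n) x≈)))
        (rotation-step true (m%n<n t n) x≈)

    a-point : ∀ s t {x} → x ≈ point s t → a k F x ≈ point (not s) (twist true t)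
    a-point s t {x} x≈ = swap (entry-pair s (<n⇒<k*2 (m%n<n t n)))
      where
      pair< : ∀ {v s} → v < 2 * k → 2 * v + bit s < 4 * k
      pair< {v} {s} v<2k = ≡.subst₂ _<_ (flip (bit s) v) (four k) (e+v*n<m*n (bit<2 s) v<2k)
        where
        flip : ∀ b v → b + v * 2 ≡ 2 * v + b
        flip = solve-∀
        four : ∀ k → 2 * k * 2 ≡ 4 * k
        four = solve-∀
      swap : (∃₂ λ v r → ∃ λ t′ → t′ < k * 2 × t′ ≋ t % n + k * (t % n) [mod n ] ×
        entry s (t % n) ≡ 2 * v + bit r × entry (not s) t′ ≡ 2 * v + bit (not r)) →
        a k F x ≈ point (not s) (twist true t)
      swap (v , r , t′ , t′< , t′≋ , eq , eq′) = reflexive (begin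
        a k F x
          ≡⟨ transpositions-swap {2 * k} (λ {v} {s} → pair< {v} {s}) {v} r v< id
               (λ i<n → i<n) v< ≡.refl (λ _ i≡v → i≡v)
               (trans x≈ (reflexive (cong elt eq))) ⟩
        elt (2 * v + bit (not r))
          ≡⟨ cong elt eq′ ⟨
        elt (entry (not s) t′)
          ≡⟨ point-entry (not s) (<k*2⇒<n t′<) ⟨
        point (not s) t′
          ≡⟨ point-cong (not s) (mod-trans t′≋ (mod-trans
               (≡⇒≋ (cong (t % n +_) (≡.sym (+-identityʳ (k * (t % n))))))
               (twist-cong true (mod-sym (mod-% t))))) ⟩
        point (not s) (twist true t) ∎)
        where
        open ≡.≡-Reasoning
        v< : v < 2 * k
        v< = *-cancelˡ-< 2 v (2 * k) (≤-<-trans (m≤m+n (2 * v) (bit r))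
          (≡.subst₂ _<_ eq (four k) (entry< s (<n⇒<k*2 (m%n<n t n)))))
          where
          four : ∀ k → 4 * k ≡ 2 * (2 * k)
          four = solve-∀

  -- Words acting on coordinates, and the Latin square

  flag : Fin 2 → Bool
  flag zero       = false
  flag (suc zero) = true

  word-point : ∀ {i j s t x} → x ≈ point s t →
    (b k F ^ᶠ j) ((a k F ^ᶠ toℕ i) x) ≈ point (s xor flag i) (twist (flag i) t + j)
  word-point {i} {j} {s} {t} {x} x≈ = iterate j
    where
    start : ∀ i → (a k F ^ᶠ toℕ i) x ≈ point (s xor flag i) (twist (flag i) t)
    start zero = trans x≈
      (reflexive (cong₂ point (≡.sym (xor-identityʳ s)) (≡.sym (+-identityʳ t))))
    start (suc zero) = trans (a-point s t x≈)
      (reflexive (cong (λ s → point s (twist true t)) (≡.sym (xor-true s))))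
      where
      xor-true : ∀ s → s xor true ≡ not s
      xor-true false = ≡.refl
      xor-true true  = ≡.refl
    iterate : ∀ j → (b k F ^ᶠ j) ((a k F ^ᶠ toℕ i) x) ≈ point (s xor flag i) (twist (flag i) t + j)
    iterate zero = trans (start i)
      (reflexive (cong (point (s xor flag i)) (≡.sym (+-identityʳ (twist (flag i) t)))))
    iterate (suc j) = trans (b-point (s xor flag i) (twist (flag i) t + j) (iterate j))
      (reflexive (cong (point (s xor flag i)) (≡.sym (+-suc (twist (flag i) t) j))))

  side : Carrier → Bool
  side x = proj₁ (point-surjective (from x))

  pos : Carrier → ℕ
  pos x = proj₁ (proj₂ (point-surjective (from x)))

  coordinates : ∀ x → x ≈ point (side x) (pos x)
  coordinates x = trans (sym (strictlyInverseˡ x)) (proj₂ (proj₂ (point-surjective (from x))))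

  side-cong : ∀ {x y} → x ≈ y → side x ≡ side y
  side-cong x≈y = cong (proj₁ ∘ point-surjective) (from-cong x≈y)

  pos-cong : ∀ {x y} → x ≈ y → pos x ≡ pos y
  pos-cong x≈y = cong (λ i → proj₁ (proj₂ (point-surjective i))) (from-cong x≈y)

  -- Here n ∸ 1 plays the role of −1.
  difference : ℕ → ℕ → ℕ
  difference t t′ = (t′ + (n ∸ 1) * t) % n

  +-difference : ∀ t t′ → t + difference t t′ ≋ t′ [mod n ]
  +-difference t t′ = mod-trans (mod-+ˡ t (mod-sym (mod-% (t′ + (n ∸ 1) * t))))
    (multiples 0 t (identity t t′ (n ∸ 1)))
    where
    identity : ∀ t t′ p → t + (t′ + p * t) + 0 ≡ t′ + t * (1 + p)
    identity = solve-∀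

  -- Regularity made explicit: `letter x y` and `exponent x y` are the i and j of the unique word
  -- bʲaⁱ that carries x to y.
  letter : Carrier → Carrier → Bool
  letter x y = side x xor side y

  exponent : Carrier → Carrier → ℕ
  exponent x y = difference (twist (letter x y) (pos x)) (pos y)

  exponent< : ∀ x y → exponent x y < n
  exponent< x y = m%n<n (pos y + (n ∸ 1) * twist (letter x y) (pos x)) n

  -- The action of bʲaⁱ, by `word-point`.
  move : Bool → ℕ → Carrier → Carrier
  move i j x = point (side x xor i) (twist i (pos x) + j)

  -- This is τ(g)x for the word g carrying x to y. It is built from coordinates alone, before any
  -- tuple is given.
  mate : Carrier → Carrier → Carrier
  mate x y = move (half (exponent x y)) (shift (letter x y) (exponent x y)) x

  mate-cong : ∀ {x x′ y y′} → x ≈ x′ → y ≈ y′ → mate x y ≈ mate x′ y′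
  mate-cong {x} {x′} {y} {y′} x≈x′ y≈y′ = reflexive (cong₂
    (λ (s , t) (s′ , t′) → let i = s xor s′; j = difference (twist i t) t′ in
      point (s xor half j) (twist (half j) t + shift i j))
    (cong₂ _,_ (side-cong x≈x′) (pos-cong x≈x′)) (cong₂ _,_ (side-cong y≈y′) (pos-cong y≈y′)))

  move-letter : ∀ x y → y ≈ move (letter x y) (exponent x y) x
  move-letter x y = trans (coordinates y) (reflexive (≡.trans
    (cong (λ s → point s (pos y)) (≡.sym (xor-absorb (side x) (side y))))
    (point-cong (side x xor letter x y)
      (mod-sym (+-difference (twist (letter x y) (pos x)) (pos y))))))
    where
    xor-absorb : ∀ s s′ → s xor (s xor s′) ≡ s′
    xor-absorb false s′ = ≡.refl
    xor-absorb true  s′ = not-involutive s′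

  move-coordinates : ∀ {i j x i′ j′ x′} → move i j x ≈ move i′ j′ x′ →
    side x xor i ≡ side x′ xor i′ × twist i (pos x) + j ≋ twist i′ (pos x′) + j′ [mod n ]
  move-coordinates = point-injective

  coordinates-injective : ∀ {x x′} → side x ≡ side x′ → pos x ≋ pos x′ [mod n ] → x ≈ x′
  coordinates-injective {x} {x′} s≡s′ t≋t′ = trans (coordinates x) (trans (reflexive (≡.trans
    (cong (λ s → point s (pos x)) s≡s′) (point-cong (side x′) t≋t′))) (sym (coordinates x′)))

  -- By regularity the given word is the one found by `letter` and `exponent`. The bound on j
  -- upgrades the congruence of exponents to an equality, which `half` requires.
  mate-move : ∀ {i j x y} → j < n → y ≈ move i j x → mate x y ≈ move (half j) (shift i j) x
  mate-move {i} {j} {x} {y} j<n y≈ = reflexive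
    (cong₂ (λ i j → move (half j) (shift i j) x) i≡ (mod-unique (exponent< x y) j<n j≋))
    where
    equal : move (letter x y) (exponent x y) x ≈ move i j x
    equal = trans (sym (move-letter x y)) y≈
    i≡ : letter x y ≡ i
    i≡ = xor-cancelˡ (side x) (proj₁ (move-coordinates {x = x} {x′ = x} equal))
    j≋ : exponent x y ≋ j [mod n ]
    j≋ = mod-+-cancelˡ (twist i (pos x))
      (≡.subst (λ i′ → twist i′ (pos x) + exponent x y ≋ twist i (pos x) + j [mod n ]) i≡
        (proj₂ (move-coordinates {x = x} {x′ = x} equal)))

  -- Here x is fixed, so injectivity of τ is what counts: the side of the value gives h, and
  -- `shift-injective` does the rest.
  mate-row-injective : ∀ x → Injective _≈_ _≈_ (mate x)
  mate-row-injective x {y} {y′} eq = trans (move-letter x y) (trans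
    (reflexive (cong₂ (λ i j → move i j x) (proj₁ same) (proj₂ same))) (sym (move-letter x y′)))
    where
    h h′ : Bool
    h  = half (exponent x y)
    h′ = half (exponent x y′)
    equal : side x xor h ≡ side x xor h′ × twist h (pos x) + shift (letter x y) (exponent x y)
      ≋ twist h′ (pos x) + shift (letter x y′) (exponent x y′) [mod n ]
    equal = move-coordinates {x = x} {x′ = x} eq
    h≡h′ : h ≡ h′
    h≡h′ = xor-cancelˡ (side x) (proj₁ equal)
    same : letter x y ≡ letter x y′ × exponent x y ≡ exponent x y′
    same = shift-injective (exponent< x y) (exponent< x y′) h≡h′
      (mod-+-cancelˡ (twist h′ (pos x)) (≡.subst
        (λ h → twist h (pos x) + shift (letter x y) (exponent x y)
          ≋ twist h′ (pos x) + shift (letter x y′) (exponent x y′) [mod n ]) h≡h′ (proj₂ equal)))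

  mate-column-injective : ∀ y → Injective _≈_ _≈_ (λ x → mate x y)
  mate-column-injective y {x} {x′} eq = coordinates-injective
    (xor-cancelʳ i′ (≡.subst (λ i → side x xor i ≡ side x′ xor i′) (proj₁ same) (proj₁ targets)))
    (proj₂ same)
    where
    i i′ : Bool
    i  = letter x y
    i′ = letter x′ y
    j j′ : ℕ
    j  = exponent x y
    j′ = exponent x′ y
    targets : side x xor i ≡ side x′ xor i′ × twist i (pos x) + j ≋ twist i′ (pos x′) + j′ [mod n ]
    targets = move-coordinates {x = x} {x′ = x′} (trans (sym (move-letter x y)) (move-letter x′ y))
    images : side x xor half j ≡ side x′ xor half j′ ×
      twist (half j) (pos x) + shift i j ≋ twist (half j′) (pos x′) + shift i′ j′ [mod n ]
    images = move-coordinates {x = x} {x′ = x′} eq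
    xor-merge : ∀ s i h → (s xor i) xor (s xor h) ≡ i xor h
    xor-merge false i     h     = ≡.refl
    xor-merge true  false h     = not-involutive h
    xor-merge true  true  h     = ≡.refl
    -- Adding the side of y to the side of the value cancels the side of x and leaves e, the
    -- exponent of a in τ(g)g⁻¹.
    e≡e′ : i xor half j ≡ i′ xor half j′
    e≡e′ = ≡.trans (≡.sym (xor-merge (side x) i (half j)))
      (≡.trans (cong₂ _xor_ (proj₁ targets) (proj₁ images)) (xor-merge (side x′) i′ (half j′)))
    same : i ≡ i′ × pos x ≋ pos x′ [mod n ]
    same = column-injective (exponent< x y) (exponent< x′ y) (proj₂ targets) e≡e′ (proj₂ images)

  move-injective : ∀ i j → Injective _≈_ _≈_ (move i j)
  move-injective i j {x} {x′} eq =
    let s≡ , t≋ = move-coordinates {x = x} {x′ = x′} eq in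
    coordinates-injective (xor-cancelʳ i s≡) (twist-injective i (mod-+-cancelʳ j t≋))

  -- The companion polynomial and its orthogonality to f

  module _ (g : Polynomial F) (g≈mate : ∀ x y → eval F g x y ≈ mate x y) where

    open Interpolation F using (eval-cong)

    g-lpp : IsLPP F g
    g-lpp =
      (λ y → injective⇒bijective {h = λ x → eval F g x y} (λ x≈x′ → eval-cong g x≈x′ refl)
        λ {x} {x′} eq → mate-column-injective y
          (trans (sym (g≈mate x y)) (trans eq (g≈mate x′ y)))) ,
      (λ x → injective⇒bijective {h = eval F g x} (λ y≈y′ → eval-cong g refl y≈y′)
        λ {y} {y′} eq → mate-row-injective x
          (trans (sym (g≈mate x y)) (trans eq (g≈mate x y′))))

    module _ (f : Polynomial F) (f-lpp : IsLPP F f) (β : Fin (4 * k) → Permutation F)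
      (β-tuple : IsTupleOf F β f) (β-words : ConsistsOfG₁ k F β) where

      private
        β⟦_⟧ : Fin (4 * k) → Carrier → Carrier
        β⟦ e ⟧ = Inverse.to (β e)

        β-move : ∀ e → ∃₂ λ i j → j < n × ∀ x → β⟦ e ⟧ x ≈ move i j x
        β-move e =
          -- Each member of the tuple trivially agrees with itself, so it belongs to G₁ and is a
          -- word.
          let j , i , β≈ = Equivalence.from (β-words (β e)) (e , λ x → refl) in
          flag i , toℕ j , toℕ<n j , λ x → trans (β≈ x) (word-point {i} {toℕ j} (coordinates x))

      orthogonal : Orthogonal F f g
      orthogonal u v = (x , β⟦ e ⟧ x) , (on-graph x , at-x) , unique
        where
        e : Fin (4 * k)
        -- The level set f = u is the graph of the tuple member with the index of u.
        e = from u
        i : Bool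
        i = proj₁ (β-move e)
        j : ℕ
        j = proj₁ (proj₂ (β-move e))
        on-graph : ∀ x → eval F f x (β⟦ e ⟧ x) ≈ u
        on-graph x = trans (proj₂ β-tuple e x) (strictlyInverseˡ u)
        along-graph : ∀ x → eval F g x (β⟦ e ⟧ x) ≈ move (half j) (shift i j) x
        along-graph x = trans (g≈mate x (β⟦ e ⟧ x))
          (mate-move (proj₁ (proj₂ (proj₂ (β-move e)))) (proj₂ (proj₂ (proj₂ (β-move e))) x))
        bijective : Bijective _≈_ _≈_ (λ x → eval F g x (β⟦ e ⟧ x))
        bijective = injective⇒bijective {h = λ x → eval F g x (β⟦ e ⟧ x)}
          (λ x≈x′ → eval-cong g x≈x′ (Inverse.to-cong (β e) x≈x′))
          λ {x} {x′} eq → move-injective (half j) (shift i j)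
            (trans (sym (along-graph x)) (trans eq (along-graph x′)))
        x : Carrier
        x = proj₁ (proj₂ bijective v)
        at-x : eval F g x (β⟦ e ⟧ x) ≈ v
        at-x = proj₂ (proj₂ bijective v) refl
        unique : ∀ {z} → eval F f (proj₁ z) (proj₂ z) ≈ u × eval F g (proj₁ z) (proj₂ z) ≈ v →
          x ≈ proj₁ z × β⟦ e ⟧ x ≈ proj₂ z
        unique {x′ , y′} (f≈u , g≈v) = x≈x′ , trans (Inverse.to-cong (β e) x≈x′) (sym y′≈)
          where
          y′≈ : y′ ≈ β⟦ e ⟧ x′
          -- Injectivity of f in its second variable forces every solution onto that graph.
          y′≈ = proj₁ (proj₂ f-lpp x′) (trans f≈u (sym (on-graph x′)))
          x≈x′ : x ≈ x′
          x≈x′ = proj₁ bijective (trans at-x (trans (sym g≈v) (eval-cong g refl y′≈)))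

-- The equation is an argument so that matching on it rewrites k inside the type of F; with k = 2(2
-- + w) the subtractions in the cycles compute.
companion : ∀ {c r} w k → k ≡ Positions.k w →
  (F : FiniteField c r (4 * k)) (f : Polynomial F) → IsLPP F f →
  (β : Fin (4 * k) → Permutation F) → IsTupleOf F β f → ConsistsOfG₁ k F β →
  HasCompanion F f
companion w _ ≡.refl F f f-lpp β β-tuple β-words =
  let g , g≈mate = interpolate₂ mate mate-cong in
  g , g-lpp g g≈mate , orthogonal g g≈mate f f-lpp β β-tuple β-words
  where
  open Action w F
  open Interpolation F using (interpolate₂)

theorem4p8 : {c r : Level} (ℓ k : ℕ) → 2 ≤ ℓ → k ≡ 2 ^ ℓ →
    (F : FiniteField c r (4 * k)) (f : Polynomial F) → IsLPP F f →
    (β : Fin (4 * k) → Permutation F) → IsTupleOf F β f → ConsistsOfG₁ k F β →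
    HasCompanion F f
-- After matching, ℓ is the original exponent minus 2, so `2 * 2 ^ ℓ` is k/2. It is at least 2, and
-- w = k/2 - 2.
theorem4p8 (suc (suc ℓ)) k (s≤s (s≤s _)) k≡2^ℓ = companion (2 * 2 ^ ℓ ∸ 2) k
  (≡.trans k≡2^ℓ (cong (2 *_) (≡.sym (ℕᵖ.m+[n∸m]≡n (ℕᵖ.*-monoʳ-≤ 2 (ℕᵖ.m^n>0 2 ℓ))))))
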